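{- The following hold. (i) For all $n\ge3$, $$[1a]_n(1,t)=t^2(t+1)^{n-2}-t^n.$$ (ii) For all $n\ge3$ and all $k\ge2$, $$[k*]_n(1,t)=\begin{cases} t^2(t+1)^{n-k-1}-t^{n-k+1}+t^{n-k} & \text{if } k<n;\\ 0 & \text{if } k\ge n.\end{cases}$$ (iii) For all $n\ge1$, the generating function for $F_n(321,2143)$ with respect to left-to-right maxima is $$T_n(1,t)=t(t+1)^{n-1}.$$
   Context: A Fishburn permutation is a permutation $\pi$ (in one-line notation) with no subsequence $\pi_j,\pi_{j+1},\pi_k$ such that $j+1<k$, $\pi_j=\pi_k+1$, and $\pi_{j+1}>\pi_j$. $F_n(321,2143)$ is the set of Fishburn permutations of length $n$ avoiding the classical patterns $321$ and $2143$. $\operatorname{inv}(\pi)$ is the number of inversions and $\operatorname{lrmax}(\pi)$ the number of left-to-right maxima (entries greater than all entries to their left). A descent is a pair of adjacent entries $\pi_j>\pi_{j+1}$. Labels (for $n\ge3$): $\pi\in F_n(321,2143)$ has label (1a) if $\pi_n=n$ and $\pi$ has a descent. For $k\ge1$, $\pi$ has label (k*) if either the rightmost $k+1$ entries of $\pi$ are $n,n-k,n-k+1,\ldots,n-2,n-1$, or $k\ge2$ and the rightmost $k$ entries of $\pi$ are $n,\ell-k+2,\ell-k+3,\ldots,\ell-1,\ell$ for some $\ell$ with $k-1<\ell<n-1$. For a label $(y)$, $[y]_n(q,t)=\sum q^{\operatorname{inv}(\pi)}t^{\operatorname{lrmax}(\pi)}$, summed over the $\pi\in F_n(321,2143)$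 with label $(y)$, and $T_n(q,t)=\sum_{\pi\in F_n(321,2143)}q^{\operatorname{inv}(\pi)}t^{\operatorname{lrmax}(\pi)}$. $[y]_n(1,t)$ and $T_n(1,t)$ are obtained by setting $q=1$. -}

module Defs where

open import Algebra.Bundles using (CommutativeRing)
open import Data.Fin.Base as Fin using (Fin; toℕ)
import Data.Fin.Properties as Fin
import Data.Integer.Properties as ℤ
open import Data.List.Base as List
  using (List; []; _∷_; allFin; applyUpTo; cartesianProduct;
         cartesianProductWith; filter; foldr; length)
open import Data.List.Membership.Propositional using (_∈_)
open import Data.List.Membership.Propositional.Properties
  using (∈-allFin; ∈-cartesianProductWith⁺)
import Data.List.Relation.Binary.Suffix.Heterogeneous.Properties as Suffix
open import Data.List.Relation.Binary.Suffix.Heterogeneous using (Suffix)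
open import Data.List.Relation.Unary.AllPairs using ([]; _∷_)
open import Data.List.Relation.Unary.All using ([])
open import Data.List.Relation.Unary.Any using (here)
open import Data.List.Relation.Unary.Unique.Propositional using (Unique)
import Data.List.Relation.Unary.Unique.Propositional.Properties as Unique
open import Data.Nat.Base using (ℕ; zero; suc; _<_; _≤_; _∸_)
import Data.Nat.Base as ℕ
import Data.Nat.Properties as ℕ
open import Data.Product.Base using (∃; ∃₂; _×_; _,_)
open import Data.Sum.Base using (_⊎_)
open import Data.Vec.Base as Vec using (Vec; []; _∷_; lookup)
import Data.Vec.Properties as Vec
open import Function.Definitions using (Injective)
open import Level using (Level; _⊔_)
open import Relation.Binary.PropositionalEquality using (_≡_; refl)
open import Relation.Nullary.Decidable
  using (Dec; yes; no; map′; ¬?; _×-dec_; _⊎-dec_; _→-dec_)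
open import Relation.Nullary.Negation using (¬_)
open import Relation.Unary using (Pred; Decidable; _∩_)
open import Relation.Unary.Properties using (_∩?_)

------------------------------------------------------------------------
-- Univariate polynomials over a commutative ring

module Polynomial {c ℓ : Level} (R : CommutativeRing c ℓ) where

  private
    module R = CommutativeRing R
    open R using (Carrier)

    open import Relation.Binary.Reasoning.Setoid R.setoid
    open import Algebra.Properties.CommutativeSemigroup
      R.+-commutativeSemigroup using (interchange; x∙yz≈y∙xz)
    open import Algebra.Properties.Ring R.ring using (-0#≈0#)

  -- Coefficient lists, constant term first.  Trailing zeros are allowed,
  -- so equality is that of the coefficients, not of the lists.
  Poly : Set c
  Poly = List Carrier

  coeff : Poly → ℕ → Carrier
  coeff []      _       = R.0#
  coeff (a ∷ p) zero    = a
  coeff (a ∷ p) (suc i) = coeff p i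

  infix  4 _≈_
  infixl 6 _+_
  infixl 7 _*_ _·_
  infix  8 -_

  -- A record, so that p and q can be inferred from a proof of p ≈ q.
  record _≈_ (p q : Poly) : Set ℓ where
    constructor coeffwise
    field at : ∀ i → coeff p i R.≈ coeff q i
  open _≈_ public

  constant : Carrier → Poly
  constant a = a ∷ []

  0# 1# X : Poly
  0# = []
  1# = constant R.1#
  X  = R.0# ∷ R.1# ∷ []

  _+_ : Poly → Poly → Poly
  []      + q       = q
  (a ∷ p) + []      = a ∷ p
  (a ∷ p) + (b ∷ q) = (a R.+ b) ∷ (p + q)

  -_ : Poly → Poly
  - p = List.map (λ a → R.- a) p

  _·_ : Carrier → Poly → Poly
  a · p = List.map (a R.*_) p

  _*_ : Poly → Poly → Poly
  []      * q = []
  (a ∷ p) * q = a · q + (R.0# ∷ p * q)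

  eval : Carrier → Poly → Carrier
  eval x []      = R.0#
  eval x (a ∷ p) = a R.+ x R.* eval x p

  coeff-+ : ∀ p q i → coeff (p + q) i R.≈ coeff p i R.+ coeff q i
  coeff-+ []      q       i       = R.sym (R.+-identityˡ _)
  coeff-+ (a ∷ p) []      i       = R.sym (R.+-identityʳ _)
  coeff-+ (a ∷ p) (b ∷ q) zero    = R.refl
  coeff-+ (a ∷ p) (b ∷ q) (suc i) = coeff-+ p q i

  coeff-neg : ∀ p i → coeff (- p) i R.≈ R.- coeff p i
  coeff-neg []      i       = R.sym -0#≈0#
  coeff-neg (a ∷ p) zero    = R.refl
  coeff-neg (a ∷ p) (suc i) = coeff-neg p i

  coeff-· : ∀ a p i → coeff (a · p) i R.≈ a R.* coeff p i
  coeff-· a []      i       = R.sym (R.zeroʳ a)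
  coeff-· a (b ∷ p) zero    = R.refl
  coeff-· a (b ∷ p) (suc i) = coeff-· a p i

  -- The Cauchy product: conv f g k is the sum of f i * g j over i + j = k.
  conv : (ℕ → Carrier) → (ℕ → Carrier) → ℕ → Carrier
  conv f g zero    = f 0 R.* g 0
  conv f g (suc k) = f 0 R.* g (suc k) R.+ conv (λ i → f (suc i)) g k

  conv-cong : ∀ {f f′ g g′} → (∀ i → f i R.≈ f′ i) → (∀ i → g i R.≈ g′ i) →
              ∀ k → conv f g k R.≈ conv f′ g′ k
  conv-cong e e′ zero    = R.*-cong (e 0) (e′ 0)
  conv-cong e e′ (suc k) =
    R.+-cong (R.*-cong (e 0) (e′ (suc k))) (conv-cong (λ i → e (suc i)) e′ k)

  conv-zeroˡ : ∀ g k → conv (λ _ → R.0#) g k R.≈ R.0#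
  conv-zeroˡ g zero    = R.zeroˡ _
  conv-zeroˡ g (suc k) =
    R.trans (R.+-cong (R.zeroˡ _) (conv-zeroˡ g k)) (R.+-identityˡ _)

  conv-distribʳ : ∀ f g h k →
    conv (λ i → f i R.+ g i) h k R.≈ conv f h k R.+ conv g h k
  conv-distribʳ f g h zero    = R.distribʳ _ _ _
  conv-distribʳ f g h (suc k) = R.trans
    (R.+-cong (R.distribʳ _ _ _) (conv-distribʳ _ _ h k))
    (interchange _ _ _ _)

  conv-scaleˡ : ∀ a f g k → conv (λ i → a R.* f i) g k R.≈ a R.* conv f g k
  conv-scaleˡ a f g zero    = R.*-assoc _ _ _
  conv-scaleˡ a f g (suc k) = R.trans
    (R.+-cong (R.*-assoc _ _ _) (conv-scaleˡ a _ g k))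
    (R.sym (R.distribˡ _ _ _))

  conv-suc : ∀ f g k →
    conv f g (suc k) R.≈ f (suc k) R.* g 0 R.+ conv f (λ i → g (suc i)) k
  conv-suc f g zero    = R.+-comm _ _
  conv-suc f g (suc k) = begin
    f 0 R.* g (suc (suc k)) R.+ conv (λ i → f (suc i)) g (suc k)
      ≈⟨ R.+-congˡ (conv-suc (λ i → f (suc i)) g k) ⟩
    f 0 R.* g (suc (suc k)) R.+ (f (suc (suc k)) R.* g 0 R.+ _)
      ≈⟨ x∙yz≈y∙xz _ _ _ ⟩
    f (suc (suc k)) R.* g 0 R.+ conv f (λ i → g (suc i)) (suc k) ∎

  conv-comm : ∀ f g k → conv f g k R.≈ conv g f k
  conv-comm f g zero    = R.*-comm _ _
  conv-comm f g (suc k) = R.trans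
    (R.+-cong (R.*-comm _ _) (conv-comm (λ i → f (suc i)) g k))
    (R.sym (conv-suc g f k))

  conv-assoc : ∀ f g h k → conv (conv f g) h k R.≈ conv f (conv g h) k
  conv-assoc f g h zero    = R.*-assoc _ _ _
  conv-assoc f g h (suc k) = begin
    f 0 R.* g 0 R.* h (suc k) R.+
      conv (λ i → f 0 R.* g (suc i) R.+ conv f′ g i) h k
      ≈⟨ R.+-cong (R.*-assoc _ _ _) (conv-distribʳ _ _ h k) ⟩
    f 0 R.* (g 0 R.* h (suc k)) R.+
      (conv (λ i → f 0 R.* g (suc i)) h k R.+ conv (conv f′ g) h k)
      ≈⟨ R.+-congˡ (R.+-cong (conv-scaleˡ (f 0) _ h k) (conv-assoc f′ g h k)) ⟩
    f 0 R.* (g 0 R.* h (suc k)) R.+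
      (f 0 R.* conv (λ i → g (suc i)) h k R.+ conv f′ (conv g h) k)
      ≈⟨ R.sym (R.+-assoc _ _ _) ⟩
    f 0 R.* (g 0 R.* h (suc k)) R.+ f 0 R.* conv (λ i → g (suc i)) h k
      R.+ conv f′ (conv g h) k
      ≈⟨ R.+-congʳ (R.sym (R.distribˡ _ _ _)) ⟩
    conv f (conv g h) (suc k) ∎
    where
    f′ : ℕ → Carrier
    f′ i = f (suc i)

  coeff-* : ∀ p q k → coeff (p * q) k R.≈ conv (coeff p) (coeff q) k
  coeff-* []      q k       = R.sym (conv-zeroˡ (coeff q) k)
  coeff-* (a ∷ p) q zero    = begin
    coeff (a · q + (R.0# ∷ p * q)) 0  ≈⟨ coeff-+ (a · q) (R.0# ∷ p * q) 0 ⟩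
    coeff (a · q) 0 R.+ R.0#          ≈⟨ R.+-identityʳ _ ⟩
    coeff (a · q) 0                   ≈⟨ coeff-· a q 0 ⟩
    a R.* coeff q 0                   ∎
  coeff-* (a ∷ p) q (suc k) = R.trans
    (coeff-+ (a · q) (R.0# ∷ p * q) (suc k))
    (R.+-cong (coeff-· a q (suc k)) (coeff-* p q k))

  private
    ≈-refl : ∀ {p} → p ≈ p
    ≈-refl = coeffwise λ _ → R.refl

    ≈-sym : ∀ {p q} → p ≈ q → q ≈ p
    ≈-sym e = coeffwise λ i → R.sym (at e i)

    ≈-trans : ∀ {p q r} → p ≈ q → q ≈ r → p ≈ r
    ≈-trans e e′ = coeffwise λ i → R.trans (at e i) (at e′ i)

    +-cong : ∀ {p p′ q q′} → p ≈ p′ → q ≈ q′ → p + q ≈ p′ + q′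
    +-cong {p} {p′} {q} {q′} e e′ = coeffwise λ i → begin
      coeff (p + q) i            ≈⟨ coeff-+ p q i ⟩
      coeff p i R.+ coeff q i    ≈⟨ R.+-cong (at e i) (at e′ i) ⟩
      coeff p′ i R.+ coeff q′ i  ≈⟨ coeff-+ p′ q′ i ⟨
      coeff (p′ + q′) i          ∎

    +-assoc : ∀ p q r → (p + q) + r ≈ p + (q + r)
    +-assoc p q r = coeffwise λ i → begin
      coeff (p + q + r) i                    ≈⟨ coeff-+ (p + q) r i ⟩
      coeff (p + q) i R.+ coeff r i          ≈⟨ R.+-congʳ (coeff-+ p q i) ⟩
      coeff p i R.+ coeff q i R.+ coeff r i  ≈⟨ R.+-assoc _ _ _ ⟩
      coeff p i R.+ (coeff q i R.+ coeff r i) ≈⟨ R.+-congˡ (coeff-+ q r i) ⟨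
      coeff p i R.+ coeff (q + r) i          ≈⟨ coeff-+ p (q + r) i ⟨
      coeff (p + (q + r)) i                  ∎

    +-comm : ∀ p q → p + q ≈ q + p
    +-comm p q = coeffwise λ i → begin
      coeff (p + q) i          ≈⟨ coeff-+ p q i ⟩
      coeff p i R.+ coeff q i  ≈⟨ R.+-comm _ _ ⟩
      coeff q i R.+ coeff p i  ≈⟨ coeff-+ q p i ⟨
      coeff (q + p) i          ∎

    +-identityʳ : ∀ p → p + 0# ≈ p
    +-identityʳ p = +-comm p 0#

    -‿cong : ∀ {p q} → p ≈ q → - p ≈ - q
    -‿cong {p} {q} e = coeffwise λ i → begin
      coeff (- p) i    ≈⟨ coeff-neg p i ⟩
      R.- coeff p i    ≈⟨ R.-‿cong (at e i) ⟩
      R.- coeff q i    ≈⟨ coeff-neg q i ⟨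
      coeff (- q) i    ∎

    -‿inverseˡ : ∀ p → - p + p ≈ 0#
    -‿inverseˡ p = coeffwise λ i → begin
      coeff (- p + p) i            ≈⟨ coeff-+ (- p) p i ⟩
      coeff (- p) i R.+ coeff p i  ≈⟨ R.+-congʳ (coeff-neg p i) ⟩
      R.- coeff p i R.+ coeff p i  ≈⟨ R.-‿inverseˡ _ ⟩
      R.0#                         ∎

    -‿inverseʳ : ∀ p → p + - p ≈ 0#
    -‿inverseʳ p = ≈-trans (+-comm p (- p)) (-‿inverseˡ p)

    *-cong : ∀ {p p′ q q′} → p ≈ p′ → q ≈ q′ → p * q ≈ p′ * q′
    *-cong {p} {p′} {q} {q′} e e′ = coeffwise λ i → begin
      coeff (p * q) i                ≈⟨ coeff-* p q i ⟩
      conv (coeff p) (coeff q) i     ≈⟨ conv-cong (at e) (at e′) i ⟩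
      conv (coeff p′) (coeff q′) i   ≈⟨ coeff-* p′ q′ i ⟨
      coeff (p′ * q′) i              ∎

    *-assoc : ∀ p q r → (p * q) * r ≈ p * (q * r)
    *-assoc p q r = coeffwise λ i → begin
      coeff (p * q * r) i
        ≈⟨ coeff-* (p * q) r i ⟩
      conv (coeff (p * q)) (coeff r) i
        ≈⟨ conv-cong (coeff-* p q) (λ _ → R.refl) i ⟩
      conv (conv (coeff p) (coeff q)) (coeff r) i
        ≈⟨ conv-assoc (coeff p) (coeff q) (coeff r) i ⟩
      conv (coeff p) (conv (coeff q) (coeff r)) i
        ≈⟨ conv-cong (λ _ → R.refl) (coeff-* q r) i ⟨
      conv (coeff p) (coeff (q * r)) i
        ≈⟨ coeff-* p (q * r) i ⟨
      coeff (p * (q * r)) i ∎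

    *-comm : ∀ p q → p * q ≈ q * p
    *-comm p q = coeffwise λ i → begin
      coeff (p * q) i             ≈⟨ coeff-* p q i ⟩
      conv (coeff p) (coeff q) i  ≈⟨ conv-comm (coeff p) (coeff q) i ⟩
      conv (coeff q) (coeff p) i  ≈⟨ coeff-* q p i ⟨
      coeff (q * p) i             ∎

    *-identityˡ : ∀ p → 1# * p ≈ p
    *-identityˡ p = coeffwise λ i → begin
      coeff (R.1# · p + (R.0# ∷ [])) i
        ≈⟨ coeff-+ (R.1# · p) (R.0# ∷ []) i ⟩
      coeff (R.1# · p) i R.+ coeff (R.0# ∷ []) i
        ≈⟨ R.+-cong (coeff-· R.1# p i) (coeff-0∷[] i) ⟩
      R.1# R.* coeff p i R.+ R.0#
        ≈⟨ R.+-identityʳ _ ⟩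
      R.1# R.* coeff p i
        ≈⟨ R.*-identityˡ _ ⟩
      coeff p i ∎
      where
      coeff-0∷[] : ∀ i → coeff (R.0# ∷ []) i R.≈ R.0#
      coeff-0∷[] zero    = R.refl
      coeff-0∷[] (suc i) = R.refl

    *-identityʳ : ∀ p → p * 1# ≈ p
    *-identityʳ p = ≈-trans (*-comm p 1#) (*-identityˡ p)

    distribʳ : ∀ p q r → (q + r) * p ≈ q * p + r * p
    distribʳ p q r = coeffwise λ i → begin
      coeff ((q + r) * p) i
        ≈⟨ coeff-* (q + r) p i ⟩
      conv (coeff (q + r)) (coeff p) i
        ≈⟨ conv-cong (coeff-+ q r) (λ _ → R.refl) i ⟩
      conv (λ j → coeff q j R.+ coeff r j) (coeff p) i
        ≈⟨ conv-distribʳ (coeff q) (coeff r) (coeff p) i ⟩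
      conv (coeff q) (coeff p) i R.+ conv (coeff r) (coeff p) i
        ≈⟨ R.+-cong (coeff-* q p i) (coeff-* r p i) ⟨
      coeff (q * p) i R.+ coeff (r * p) i
        ≈⟨ coeff-+ (q * p) (r * p) i ⟨
      coeff (q * p + r * p) i ∎

    distribˡ : ∀ p q r → p * (q + r) ≈ p * q + p * r
    distribˡ p q r = ≈-trans (*-comm p (q + r))
      (≈-trans (distribʳ p q r) (+-cong (*-comm q p) (*-comm r p)))

  commutativeRing : CommutativeRing c ℓ
  commutativeRing = record
    { Carrier = Poly
    ; _≈_     = _≈_
    ; _+_     = _+_
    ; _*_     = _*_
    ; -_      = -_
    ; 0#      = 0#
    ; 1#      = 1#
    ; isCommutativeRing = record
      { isRing = record
        { +-isAbelianGroup = record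
          { isGroup = record
            { isMonoid = record
              { isSemigroup = record
                { isMagma = record
                  { isEquivalence = record
                    { refl = ≈-refl ; sym = ≈-sym ; trans = ≈-trans }
                  ; ∙-cong = +-cong
                  }
                ; assoc = +-assoc
                }
              ; identity = (λ _ → ≈-refl) , +-identityʳ
              }
            ; inverse = -‿inverseˡ , -‿inverseʳ
            ; ⁻¹-cong = -‿cong
            }
          ; comm = +-comm
          }
        ; *-cong     = *-cong
        ; *-assoc    = *-assoc
        ; *-identity = *-identityˡ , *-identityʳ
        ; distrib    = distribˡ , distribʳ
        }
      ; *-comm = *-comm
      }
    }

module ℤ[t] where
  private module P = Polynomial ℤ.+-*-commutativeRing
  open P public using (commutativeRing)
  open CommutativeRing P.commutativeRing public
  open import Algebra.Properties.Semiring.Exp semiring public using (_^_)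

  t : Carrier
  t = P.X

-- ℤ[q,t], realised as the ring (ℤ[t])[q].
module ℤ[q,t] where
  private module P = Polynomial ℤ[t].commutativeRing
  open P public using (commutativeRing)
  open CommutativeRing P.commutativeRing public
  open import Algebra.Properties.Semiring.Exp semiring public using (_^_)

  q t : Carrier
  q = P.X
  t = P.constant ℤ[t].t

  ∑ : ∀ {a} {A : Set a} → List A → (A → Carrier) → Carrier
  ∑ xs f = foldr (λ x s → f x + s) 0# xs

  infix 9 _∣q=1

  _∣q=1 : Carrier → ℤ[t].Carrier
  p ∣q=1 = P.eval ℤ[t].1# p

------------------------------------------------------------------------
-- Words and permutations

-- Positions and values are numbered from 0 in Word n; oneLine below
-- gives the entries as elements of {1,…,n}.
Word : ℕ → Set
Word n = Vec (Fin n) n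

vectors : ∀ n k → List (Vec (Fin n) k)
vectors n zero    = [] ∷ []
vectors n (suc k) = cartesianProductWith _∷_ (allFin n) (vectors n k)

vectors-complete : ∀ {n k} (v : Vec (Fin n) k) → v ∈ vectors n k
vectors-complete []      = here refl
vectors-complete (x ∷ v) =
  ∈-cartesianProductWith⁺ _∷_ (∈-allFin x) (vectors-complete v)

vectors-unique : ∀ n k → Unique (vectors n k)
vectors-unique n zero    = [] ∷ []
vectors-unique n (suc k) = Unique.cartesianProductWith⁺ _∷_
  Vec.∷-injective (Unique.allFin⁺ n) (vectors-unique n k)

IsPermutation : ∀ {n} → Pred (Word n) _
IsPermutation π = Injective _≡_ _≡_ (lookup π)

isPermutation? : ∀ {n} → Decidable (IsPermutation {n})
isPermutation? π = map′ (λ inj {i} {j} → inj i j) (λ inj i j → inj {i} {j})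
  (Fin.all? λ i → Fin.all? λ j →
    (lookup π i Fin.≟ lookup π j) →-dec (i Fin.≟ j))

Consecutive : ∀ {n} → Fin n → Fin n → Set
Consecutive i j = toℕ j ≡ suc (toℕ i)

consecutive? : ∀ {n} (i j : Fin n) → Dec (Consecutive i j)
consecutive? i j = toℕ j ℕ.≟ suc (toℕ i)

-- The positions i, j, k stand for j, j+1, k in π_j, π_{j+1}, π_k.
FishburnPattern : ∀ {n} → Word n → Fin n → Fin n → Fin n → Set
FishburnPattern π i j k =
  Consecutive i j × j Fin.< k ×
  Consecutive (lookup π k) (lookup π i) × lookup π i Fin.< lookup π j

IsFishburn : ∀ {n} → Pred (Word n) _
IsFishburn π = ¬ (∃ λ i → ∃₂ λ j k → FishburnPattern π i j k)

isFishburn? : ∀ {n} → Decidable (IsFishburn {n})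
isFishburn? π = ¬? (Fin.any? λ i → Fin.any? λ j → Fin.any? λ k →
  consecutive? i j ×-dec j Fin.<? k ×-dec
  consecutive? (lookup π k) (lookup π i) ×-dec lookup π i Fin.<? lookup π j)

------------------------------------------------------------------------
-- Classical pattern avoidance

-- The positions f pick out a subsequence of π order-isomorphic to σ.
IsOccurrence : ∀ {n k} → Vec ℕ k → Word n → Vec (Fin n) k → Set
IsOccurrence σ π f = ∀ a b →
  (a Fin.< b → lookup f a Fin.< lookup f b) ×
  (lookup σ a < lookup σ b → lookup π (lookup f a) Fin.< lookup π (lookup f b)) ×
  (lookup π (lookup f a) Fin.< lookup π (lookup f b) → lookup σ a < lookup σ b)

Avoids : ∀ {n k} → Vec ℕ k → Pred (Word n) _
Avoids σ π = ¬ ∃ (IsOccurrence σ π)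

anyVec? : ∀ {n k p} {P : Pred (Vec (Fin n) k) p} → Decidable P → Dec (∃ P)
anyVec? {k = zero}  P? = map′ ([] ,_) (λ { ([] , p) → p }) (P? [])
anyVec? {k = suc k} P? =
  map′ (λ { (x , v , p) → x ∷ v , p }) (λ { (x ∷ v , p) → x , v , p })
    (Fin.any? λ x → anyVec? λ v → P? (x ∷ v))

avoids? : ∀ {n k} (σ : Vec ℕ k) → Decidable (Avoids {n} σ)
avoids? σ π = ¬? (anyVec? λ f → Fin.all? λ a → Fin.all? λ b →
  (a Fin.<? b →-dec lookup f a Fin.<? lookup f b) ×-dec
  (lookup σ a ℕ.<? lookup σ b →-dec
    lookup π (lookup f a) Fin.<? lookup π (lookup f b)) ×-dec
  (lookup π (lookup f a) Fin.<? lookup π (lookup f b) →-dec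
    lookup σ a ℕ.<? lookup σ b))

p321 : Vec ℕ 3
p321 = 3 ∷ 2 ∷ 1 ∷ []

p2143 : Vec ℕ 4
p2143 = 2 ∷ 1 ∷ 4 ∷ 3 ∷ []

InF : ∀ {n} → Pred (Word n) _
InF = IsPermutation ∩ IsFishburn ∩ Avoids p321 ∩ Avoids p2143

inF? : ∀ {n} → Decidable (InF {n})
inF? = isPermutation? ∩? isFishburn? ∩? avoids? p321 ∩? avoids? p2143

F : ∀ n → List (Word n)
F n = filter inF? (vectors n n)

------------------------------------------------------------------------
-- Statistics

inv : ∀ {n} → Word n → ℕ
inv {n} π = length (filter
  (λ (i , j) → i Fin.<? j ×-dec lookup π j Fin.<? lookup π i)
  (cartesianProduct (allFin n) (allFin n)))

IsLRMax : ∀ {n} → Word n → Pred (Fin n) _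
IsLRMax π i = ∀ j → j Fin.< i → lookup π j Fin.< lookup π i

isLRMax? : ∀ {n} (π : Word n) → Decidable (IsLRMax π)
isLRMax? π i = Fin.all? λ j → j Fin.<? i →-dec lookup π j Fin.<? lookup π i

lrmax : ∀ {n} → Word n → ℕ
lrmax {n} π = length (filter (isLRMax? π) (allFin n))

HasDescent : ∀ {n} → Pred (Word n) _
HasDescent π = ∃₂ λ i j → Consecutive i j × lookup π j Fin.< lookup π i

hasDescent? : ∀ {n} → Decidable (HasDescent {n})
hasDescent? π = Fin.any? λ i → Fin.any? λ j →
  consecutive? i j ×-dec lookup π j Fin.<? lookup π i

------------------------------------------------------------------------
-- Labels

oneLine : ∀ {n} → Word n → List ℕ
oneLine π = List.map (λ x → suc (toℕ x)) (Vec.toList π)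

EndsIn : ∀ {n} → Word n → List ℕ → Set
EndsIn π xs = Suffix _≡_ xs (oneLine π)

endsIn? : ∀ {n} (π : Word n) xs → Dec (EndsIn π xs)
endsIn? π xs = Suffix.suffix? ℕ._≟_ xs (oneLine π)

-- The list s, s+1, …, s+m-1.
run : ℕ → ℕ → List ℕ
run s m = applyUpTo (s ℕ.+_) m

Label1a : ∀ {n} → Pred (Word n) _
Label1a {n} π = EndsIn π (n ∷ []) × HasDescent π

label1a? : ∀ {n} → Decidable (Label1a {n})
label1a? {n} π = endsIn? π (n ∷ []) ×-dec hasDescent? π

-- Truncated subtraction is harmless: for k ≥ n the first list is too long
-- to be a suffix of π, and k - 1 < ℓ gives ℓ + 2 ≥ k.
Label* : ∀ {n} → ℕ → Pred (Word n) _
Label* {n} k π =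
  EndsIn π (n ∷ run (n ∸ k) k) ⊎
  (2 ≤ k × ∃ λ ℓ → ℓ < n ∸ 1 × k ∸ 1 < ℓ ×
    EndsIn π (n ∷ run (ℓ ℕ.+ 2 ∸ k) (k ∸ 1)))

label*? : ∀ {n} k → Decidable (Label* {n} k)
label*? {n} k π =
  endsIn? π (n ∷ run (n ∸ k) k) ⊎-dec
  (2 ℕ.≤? k ×-dec
    ℕ.anyUpTo? (λ ℓ → k ∸ 1 ℕ.<? ℓ ×-dec
      endsIn? π (n ∷ run (ℓ ℕ.+ 2 ∸ k) (k ∸ 1))) (n ∸ 1))

------------------------------------------------------------------------
-- Generating functions in ℤ[q,t]

weight : ∀ {n} → Word n → ℤ[q,t].Carrier
weight π = q ^ inv π * t ^ lrmax π
  where open ℤ[q,t]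

T : ℕ → ℤ[q,t].Carrier
T n = ℤ[q,t].∑ (F n) weight

[1a] : ℕ → ℤ[q,t].Carrier
[1a] n = ℤ[q,t].∑ (filter label1a? (F n)) weight

[_*] : ℕ → ℕ → ℤ[q,t].Carrier
[ k *] n = ℤ[q,t].∑ (filter (label*? k) (F n)) weight

{-# OPTIONS --safe #-}

-- If π ∈ F_n(321,2143) starts with its minimum, then deleting that entry gives
-- an arbitrary element of F_{n-1}(321,2143).  Otherwise π starts with some
-- m > 1; avoiding 321 and the Fishburn pattern forces the second entry to be 1,
-- and then avoiding 321 and 2143 makes both the values below m and the values
-- from m on increasing.  Conversely, every such merge of two increasing runs lies
-- in F_n(321,2143), so these π correspond to arbitrary words in {small, large}
-- of length n - 2, and their left-to-right maxima are the large values.  Hence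
-- T_n = t T_{n-1} + t (t+1)^{n-2}.  The labels are unaffected by the deletion,
-- and on the second class they say which final letters the word has, so
-- [1a]_n and [k*]_n satisfy similar recurrences.

module Submission where

-- On the second class the value n is carried by the last large letter. A label therefore counts the
-- small letters after that letter: none for (1a), and k - 1 for (k*). All earlier letters after the
-- first two are free, so words with r free letters contribute t · t (t+1)^r. Every recurrence has
-- the form S_(r+1) = t S_r + t^2 (t+1)^r, of which t^2 (t+1)^r is a particular solution. The
-- remaining powers of t solve the homogeneous recurrence and are fixed by the initial value. For
-- (1a) this value is 0 at n = 2, whence -t^n. For (k*) it is t at n = k + 1, whence -t^(n-k+1) +
-- t^(n-k). The value t comes from one exceptional permutation, n 1 2 ... n-1, which has k small
-- letters after n rather than k - 1 and is the reason for the first alternative in the definition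
-- of (k*).

open import Defs
open import Algebra.Bundles using (CommutativeRing)
open import Data.Bool.Base using (Bool; true; false; if_then_else_)
import Data.Bool.Properties as Bool
open import Data.Fin.Base as Fin using (Fin; zero; suc; toℕ; fromℕ<)
import Data.Fin.Properties as Fin
open import Data.List.Base as List using (List; []; _∷_; _++_; filter; foldr)
import Data.List.Properties as List
open import Data.List.Membership.Propositional using (_∈_)
open import Data.List.Membership.Propositional.Properties
  using (∈-map⁺; ∈-map⁻; ∈-++⁺ˡ; ∈-++⁺ʳ; ∈-++⁻; ∈-filter⁺; ∈-filter⁻)
open import Data.List.Membership.Propositional.Properties.WithK using (unique∧set⇒bag)
open import Data.List.Relation.Binary.BagAndSetEquality using (∼bag⇒↭)
open import Data.List.Relation.Binary.Permutation.Propositional as Perm using (_↭_)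
open import Data.List.Relation.Binary.Pointwise as Pointwise using (Pointwise; []; _∷_)
open import Data.List.Relation.Binary.Suffix.Heterogeneous as Suffix using (Suffix; here; there)
import Data.List.Relation.Binary.Suffix.Heterogeneous.Properties as Suffix
open import Data.List.Relation.Unary.All using ([])
open import Data.List.Relation.Unary.AllPairs using ([]; _∷_)
open import Data.List.Relation.Unary.Any using (here)
open import Data.List.Relation.Unary.Unique.Propositional using (Unique)
import Data.List.Relation.Unary.Unique.Propositional.Properties as Unique
open import Data.Nat.Base as ℕ using (ℕ; zero; suc; _≤_; _<_; _∸_; z≤n; s≤s; s≤s⁻¹)
import Data.Nat.Properties as ℕ
open import Data.Product.Base using (∃; ∃₂; _×_; _,_; proj₁; proj₂)
open import Data.Sum.Base as Sum using (_⊎_; inj₁; inj₂)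
open import Data.Vec.Base as Vec using (Vec; []; _∷_; lookup; replicate)
import Data.Vec.Properties as Vec
open import Function.Base using (_∘_; id)
open import Function.Bundles using (_⇔_; mk⇔; Equivalence)
open import Function.Construct.Composition using (_⇔-∘_)
open import Function.Definitions using (Injective)
open import Relation.Binary.Definitions using (tri<; tri≈; tri>)
open import Relation.Binary.PropositionalEquality
  using (_≡_; _≢_; refl; sym; trans; cong; cong₂; subst; subst₂; module ≡-Reasoning)
open import Relation.Nullary.Decidable
  using (yes; no; does; from-yes; _→-dec_; dec-true; dec-false)
open import Relation.Nullary.Negation using (¬_; contradiction)
open import Relation.Unary using (Pred; Decidable; U; _∩_; _∪_)

private variable
  n p : ℕ

-- Pattern avoidance and the first entry

Contains321 : Word n → Set
Contains321 π = ∃ λ i → ∃₂ λ j k → i Fin.< j × j Fin.< k ×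
  lookup π j Fin.< lookup π i × lookup π k Fin.< lookup π j

Contains2143 : Word n → Set
Contains2143 π = ∃₂ λ i j → ∃₂ λ k l → i Fin.< j × j Fin.< k × k Fin.< l ×
  lookup π j Fin.< lookup π i × lookup π i Fin.< lookup π l ×
  lookup π l Fin.< lookup π k

-- Preserving the strict order is enough: if the entries of `σ` are distinct, any two are
-- comparable, so a failure to reflect the order would contradict asymmetry or irreflexivity in `π`.
isOccurrence : ∀ {k} {σ : Vec ℕ k} {π : Word n} {f} →
  Injective _≡_ _≡_ (lookup σ) →
  (∀ a b → a Fin.< b → lookup f a Fin.< lookup f b) →
  (∀ a b → lookup σ a < lookup σ b →
    lookup π (lookup f a) Fin.< lookup π (lookup f b)) →
  IsOccurrence σ π f
isOccurrence {σ = σ} {π} {f} inj incr mono a b = incr a b , mono a b , reflects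
  where
  reflects : lookup π (lookup f a) Fin.< lookup π (lookup f b) →
             lookup σ a < lookup σ b
  reflects πa<πb with ℕ.<-cmp (lookup σ a) (lookup σ b)
  ... | tri< σa<σb _ _ = σa<σb
  ... | tri> _ _ σb<σa = contradiction πa<πb (ℕ.<-asym (mono b a σb<σa))
  ... | tri≈ _ σa≡σb _ with refl ← inj σa≡σb = contradiction πa<πb (ℕ.<-irrefl refl)

p321-injective : Injective _≡_ _≡_ (lookup p321)
p321-injective {a} {b} = from-yes (Fin.all? λ a → Fin.all? λ b →
  (lookup p321 a ℕ.≟ lookup p321 b) →-dec (a Fin.≟ b)) a b

p2143-injective : Injective _≡_ _≡_ (lookup p2143)
p2143-injective {a} {b} = from-yes (Fin.all? λ a → Fin.all? λ b →
  (lookup p2143 a ℕ.≟ lookup p2143 b) →-dec (a Fin.≟ b)) a b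

pattern 0F = zero
pattern 1F = suc zero
pattern 2F = suc (suc zero)
pattern 3F = suc (suc (suc zero))

avoids321 : (π : Word n) → Avoids p321 π ⇔ (¬ Contains321 π)
avoids321 π = mk⇔ to from
  where
  to : Avoids p321 π → ¬ Contains321 π
  to av (i , j , k , i<j , j<k , j↓i , k↓j) =
    av (f , isOccurrence {σ = p321} {π} {f} p321-injective incr mono)
    where
    f = i ∷ j ∷ k ∷ []
    incr : ∀ a b → a Fin.< b → lookup f a Fin.< lookup f b
    incr 0F 1F _ = i<j
    incr 0F 2F _ = ℕ.<-trans i<j j<k
    incr 1F 2F _ = j<k
    incr 1F 1F (s≤s ())
    incr 2F 1F (s≤s ())
    incr 2F 2F (s≤s (s≤s ()))
    mono : ∀ a b → lookup p321 a < lookup p321 b →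
           lookup π (lookup f a) Fin.< lookup π (lookup f b)
    mono 1F 0F _ = j↓i
    mono 2F 0F _ = ℕ.<-trans k↓j j↓i
    mono 2F 1F _ = k↓j
    mono 0F 0F (s≤s (s≤s (s≤s ())))
    mono 0F 1F (s≤s (s≤s ()))
    mono 0F 2F (s≤s ())
    mono 1F 1F (s≤s (s≤s ()))
    mono 1F 2F (s≤s ())
    mono 2F 2F (s≤s ())
  from : ¬ Contains321 π → Avoids p321 π
  from ¬c (i ∷ j ∷ k ∷ [] , occ) = ¬c (i , j , k ,
    proj₁ (occ 0F 1F) (s≤s z≤n) , proj₁ (occ 1F 2F) (s≤s (s≤s z≤n)) ,
    proj₁ (proj₂ (occ 1F 0F)) (from-yes (2 ℕ.<? 3)) ,
    proj₁ (proj₂ (occ 2F 1F)) (from-yes (1 ℕ.<? 2)))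

avoids2143 : (π : Word n) → Avoids p2143 π ⇔ (¬ Contains2143 π)
avoids2143 π = mk⇔ to from
  where
  to : Avoids p2143 π → ¬ Contains2143 π
  to av (i , j , k , l , i<j , j<k , k<l , j↓i , i↓l , l↓k) =
    av (f , isOccurrence {σ = p2143} {π} {f} p2143-injective incr mono)
    where
    f = i ∷ j ∷ k ∷ l ∷ []
    incr : ∀ a b → a Fin.< b → lookup f a Fin.< lookup f b
    incr 0F 1F _ = i<j
    incr 0F 2F _ = ℕ.<-trans i<j j<k
    incr 0F 3F _ = ℕ.<-trans i<j (ℕ.<-trans j<k k<l)
    incr 1F 2F _ = j<k
    incr 1F 3F _ = ℕ.<-trans j<k k<l
    incr 2F 3F _ = k<l
    incr 1F 1F (s≤s ())
    incr 2F 1F (s≤s ())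
    incr 3F 1F (s≤s ())
    incr 2F 2F (s≤s (s≤s ()))
    incr 3F 2F (s≤s (s≤s ()))
    incr 3F 3F (s≤s (s≤s (s≤s ())))
    mono : ∀ a b → lookup p2143 a < lookup p2143 b →
           lookup π (lookup f a) Fin.< lookup π (lookup f b)
    mono 0F 2F _ = ℕ.<-trans i↓l l↓k
    mono 0F 3F _ = i↓l
    mono 1F 0F _ = j↓i
    mono 1F 2F _ = ℕ.<-trans j↓i (ℕ.<-trans i↓l l↓k)
    mono 1F 3F _ = ℕ.<-trans j↓i i↓l
    mono 3F 2F _ = l↓k
    mono 0F 0F (s≤s (s≤s ()))
    mono 0F 1F (s≤s ())
    mono 1F 1F (s≤s ())
    mono 2F 0F (s≤s (s≤s ()))
    mono 2F 1F (s≤s ())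
    mono 2F 2F (s≤s (s≤s (s≤s (s≤s ()))))
    mono 2F 3F (s≤s (s≤s (s≤s ())))
    mono 3F 0F (s≤s (s≤s ()))
    mono 3F 1F (s≤s ())
    mono 3F 3F (s≤s (s≤s (s≤s ())))
  from : ¬ Contains2143 π → Avoids p2143 π
  from ¬c (i ∷ j ∷ k ∷ l ∷ [] , occ) = ¬c (i , j , k , l ,
    proj₁ (occ 0F 1F) (s≤s z≤n) , proj₁ (occ 1F 2F) (s≤s (s≤s z≤n)) ,
    proj₁ (occ 2F 3F) (s≤s (s≤s (s≤s z≤n))) ,
    proj₁ (proj₂ (occ 1F 0F)) (from-yes (1 ℕ.<? 2)) ,
    proj₁ (proj₂ (occ 0F 3F)) (from-yes (2 ℕ.<? 3)) ,
    proj₁ (proj₂ (occ 3F 2F)) (from-yes (3 ℕ.<? 4)))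

-- Pigeonhole: if `z` were missed, `punchOut` would remove it from the codomain and leave an
-- injection into a smaller set.
injective⇒surjective : ∀ {f : Fin n → Fin n} → Injective _≡_ _≡_ f →
                       ∀ z → ∃ λ i → f i ≡ z
injective⇒surjective {suc n} {f} inj z with Fin.any? (λ i → f i Fin.≟ z)
... | yes hit = hit
... | no miss = contradiction
  (λ {i} {j} eq → inj (Fin.punchOut-injective (avoid i) (avoid j) eq))
  (Fin.<⇒notInjective (ℕ.n<1+n n))
  where
  avoid : ∀ i → z ≢ f i
  avoid i eq = miss (i , sym eq)

-- Deletion of a leading minimum

prepend : Word n → Word (suc n)
prepend σ = zero ∷ Vec.map suc σ

module _ {σ : Word n} where

  lookup-prepend : ∀ i → lookup (prepend σ) (suc i) ≡ suc (lookup σ i)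
  lookup-prepend i = Vec.lookup-map i suc σ

  toℕ-prepend : ∀ i → toℕ (lookup (prepend σ) (suc i)) ≡ suc (toℕ (lookup σ i))
  toℕ-prepend i = cong toℕ (lookup-prepend i)

  prepend-< : ∀ {i j} → lookup σ i Fin.< lookup σ j →
              lookup (prepend σ) (suc i) Fin.< lookup (prepend σ) (suc j)
  prepend-< {i} {j} lt = subst₂ _<_ (sym (toℕ-prepend i)) (sym (toℕ-prepend j)) (s≤s lt)

  prepend-<⁻ : ∀ {i j} → lookup (prepend σ) (suc i) Fin.< lookup (prepend σ) (suc j) →
               lookup σ i Fin.< lookup σ j
  prepend-<⁻ {i} {j} lt = s≤s⁻¹ (subst₂ _<_ (toℕ-prepend i) (toℕ-prepend j) lt)

  prepend-consecutive : ∀ {i j} → Consecutive (lookup σ i) (lookup σ j) →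
    Consecutive (lookup (prepend σ) (suc i)) (lookup (prepend σ) (suc j))
  prepend-consecutive {i} {j} eq =
    trans (toℕ-prepend j) (cong suc (trans eq (sym (toℕ-prepend i))))

  prepend-consecutive⁻ : ∀ {i j} →
    Consecutive (lookup (prepend σ) (suc i)) (lookup (prepend σ) (suc j)) →
    Consecutive (lookup σ i) (lookup σ j)
  prepend-consecutive⁻ {i} {j} eq =
    ℕ.suc-injective (trans (sym (toℕ-prepend j)) (trans eq (cong suc (toℕ-prepend i))))

  -- The first entry of each forbidden pattern exceeds some later entry of the pattern, so a leading
  -- minimum takes part in no occurrence.
  prepend-InF : InF σ → InF (prepend σ)
  prepend-InF (inj , fish , av321 , av2143) =
    inj′ , fish′ , Equivalence.from (avoids321 (prepend σ)) ¬321 , Equivalence.from (avoids2143 (prepend σ)) ¬2143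
    where
    inj′ : IsPermutation (prepend σ)
    inj′ {zero}  {zero}  _  = refl
    inj′ {zero}  {suc j} eq with () ← trans eq (lookup-prepend j)
    inj′ {suc i} {zero}  eq with () ← trans (sym eq) (lookup-prepend i)
    inj′ {suc i} {suc j} eq = cong suc (inj (Fin.suc-injective
      (trans (sym (lookup-prepend i)) (trans eq (lookup-prepend j)))))
    fish′ : IsFishburn (prepend σ)
    fish′ (zero  , _     , _     , _   , _       , ()  , _)
    fish′ (suc i , suc j , suc k , i∼j , s≤s j<k , k∼i , i<j) =
      fish (i , j , k , ℕ.suc-injective i∼j , j<k , prepend-consecutive⁻ {k} {i} k∼i ,
            prepend-<⁻ {i} {j} i<j)
    ¬321 : ¬ Contains321 (prepend σ)
    ¬321 (zero , _ , _ , _ , _ , () , _)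
    ¬321 (suc i , suc j , suc k , s≤s i<j , s≤s j<k , j↓i , k↓j) =
      Equivalence.to (avoids321 σ) av321
        (i , j , k , i<j , j<k , prepend-<⁻ {j} {i} j↓i , prepend-<⁻ {k} {j} k↓j)
    ¬2143 : ¬ Contains2143 (prepend σ)
    ¬2143 (zero , _ , _ , _ , _ , _ , _ , () , _)
    ¬2143 (suc i , suc j , suc k , suc l , s≤s i<j , s≤s j<k , s≤s k<l , j↓i , i↓l , l↓k) =
      Equivalence.to (avoids2143 σ) av2143
        (i , j , k , l , i<j , j<k , k<l ,
         prepend-<⁻ {j} {i} j↓i , prepend-<⁻ {i} {l} i↓l , prepend-<⁻ {l} {k} l↓k)

  prepend-InF⁻ : InF (prepend σ) → InF σ
  prepend-InF⁻ (inj , fish , av321 , av2143) =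
    inj′ , fish′ , Equivalence.from (avoids321 σ) ¬321 , Equivalence.from (avoids2143 σ) ¬2143
    where
    inj′ : IsPermutation σ
    inj′ {i} {j} eq = Fin.suc-injective (inj
      (trans (lookup-prepend i) (trans (cong suc eq) (sym (lookup-prepend j)))))
    fish′ : IsFishburn σ
    fish′ (i , j , k , i∼j , j<k , k∼i , i<j) =
      fish (suc i , suc j , suc k , cong suc i∼j , s≤s j<k , prepend-consecutive {k} {i} k∼i ,
            prepend-< {i} {j} i<j)
    ¬321 : ¬ Contains321 σ
    ¬321 (i , j , k , i<j , j<k , j↓i , k↓j) =
      Equivalence.to (avoids321 (prepend σ)) av321
        (suc i , suc j , suc k , s≤s i<j , s≤s j<k , prepend-< {j} {i} j↓i , prepend-< {k} {j} k↓j)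
    ¬2143 : ¬ Contains2143 σ
    ¬2143 (i , j , k , l , i<j , j<k , k<l , j↓i , i↓l , l↓k) =
      Equivalence.to (avoids2143 (prepend σ)) av2143
        (suc i , suc j , suc k , suc l , s≤s i<j , s≤s j<k , s≤s k<l ,
         prepend-< {j} {i} j↓i , prepend-< {i} {l} i↓l , prepend-< {l} {k} l↓k)

map-injective : ∀ {A B : Set} {f : A → B} → Injective _≡_ _≡_ f →
                ∀ {n} → Injective _≡_ _≡_ (Vec.map {n = n} f)
map-injective inj {_} {[]}     {[]}     _  = refl
map-injective inj {_} {x ∷ xs} {y ∷ ys} eq = cong₂ _∷_
  (inj (Vec.∷-injectiveˡ eq)) (map-injective inj (Vec.∷-injectiveʳ eq))

prepend-injective : {σ τ : Word n} → prepend σ ≡ prepend τ → σ ≡ τ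
prepend-injective eq = map-injective Fin.suc-injective (Vec.∷-injectiveʳ eq)

unmap-suc : (v : Vec (Fin (suc n)) p) → (∀ i → lookup v i ≢ zero) →
            ∃ λ w → v ≡ Vec.map suc w
unmap-suc []          _  = [] , refl
unmap-suc (zero  ∷ v) ≢0 = contradiction refl (≢0 zero)
unmap-suc (suc x ∷ v) ≢0 with w , refl ← unmap-suc v (≢0 ∘ suc) = x ∷ w , refl

starts-with-zero : {π : Word (suc n)} → InF π → lookup π zero ≡ zero →
                   ∃ λ σ → InF σ × π ≡ prepend σ
starts-with-zero {π = .zero ∷ v} π∈F@(inj , _) refl
  with σ , refl ← unmap-suc v (λ i eq → Fin.0≢1+n (sym (inj {suc i} {zero} eq))) =
  σ , prepend-InF⁻ π∈F , refl

-- Permutations that do not start with their minimum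

record TwoRuns (π : Word (2 ℕ.+ p)) : Set where
  field
    head≢0 : lookup π zero ≢ zero
    next≡0 : lookup π (suc zero) ≡ zero
    small-increasing : ∀ {i j} → i Fin.< j → lookup π i Fin.< lookup π zero →
      lookup π j Fin.< lookup π zero → lookup π i Fin.< lookup π j
    large-increasing : ∀ {i j} → i Fin.< j → lookup π zero Fin.≤ lookup π i →
      lookup π zero Fin.≤ lookup π j → lookup π i Fin.< lookup π j

≢zero⇒0< : ∀ {x : Fin (suc n)} → x ≢ zero → 0 < toℕ x
≢zero⇒0< {x = zero}  x≢0 = contradiction refl x≢0
≢zero⇒0< {x = suc _} _   = s≤s z≤n

InF⇒TwoRuns : {π : Word (2 ℕ.+ p)} → InF π → lookup π zero ≢ zero → TwoRuns π
InF⇒TwoRuns {π = π} (inj , fish , av321 , av2143) π₀≢0 = record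
  { head≢0 = π₀≢0
  ; next≡0 = next≡0
  ; small-increasing = small
  ; large-increasing = large
  }
  where
  0<π₀ : 0 < toℕ (lookup π zero)
  0<π₀ = ≢zero⇒0< π₀≢0

  ≮⇒> : ∀ {i j} → i Fin.< j → ¬ (lookup π i Fin.< lookup π j) → lookup π j Fin.< lookup π i
  ≮⇒> i<j ≮ = ℕ.≤∧≢⇒< (ℕ.≮⇒≥ ≮)
    λ eq → ℕ.<-irrefl (cong toℕ (sym (inj (Fin.toℕ-injective eq)))) i<j

  ¬321 = Equivalence.to (avoids321 π) av321
  ¬2143 = Equivalence.to (avoids2143 π) av2143

  -- Otherwise either π₀, π₁, 0 form a 321, or π₀ < π₁ and the value π₀ - 1,
  -- which lies to the right of π₁, completes a Fishburn pattern.
  next≡0 : lookup π (suc zero) ≡ zero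
  next≡0 with injective⇒surjective inj zero
  ... | zero , eq     = contradiction eq π₀≢0
  ... | suc zero , eq = eq
  ... | suc (suc z) , eq with toℕ (lookup π (suc zero)) ℕ.<? toℕ (lookup π zero)
  ...   | yes 1<0 = contradiction
    (zero , suc zero , suc (suc z) , s≤s z≤n , s≤s (s≤s z≤n) , 1<0 ,
      subst (λ x → toℕ x < toℕ (lookup π (suc zero))) (sym eq)
        (≢zero⇒0< λ eq′ → Fin.0≢1+n (Fin.suc-injective (inj (trans eq′ (sym eq))))))
    ¬321
  ...   | no 1≮0 with lookup π zero in π₀≡
  ...     | zero = contradiction refl π₀≢0
  ...     | suc x with injective⇒surjective inj (Fin.inject₁ x)
  ...       | zero , eq′ = contradiction (cong toℕ (trans (sym π₀≡) eq′))
                (ℕ.1+n≢n ∘ λ e → trans e (Fin.toℕ-inject₁ x))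
  ...       | suc zero , eq′ = contradiction
                (subst (_< suc (toℕ x))
                  (sym (trans (cong toℕ eq′) (Fin.toℕ-inject₁ x))) (ℕ.n<1+n _)) 1≮0
  ...       | suc (suc k) , eq′ = contradiction
                (zero , suc zero , suc (suc k) , refl , s≤s (s≤s z≤n) ,
                  trans (cong toℕ π₀≡) (cong suc (sym (trans (cong toℕ eq′) (Fin.toℕ-inject₁ x)))) ,
                  ℕ.≤∧≢⇒< (ℕ.≤-trans (ℕ.≤-reflexive (cong toℕ π₀≡)) (ℕ.≮⇒≥ 1≮0))
                    λ e → Fin.0≢1+n (inj (Fin.toℕ-injective e)))
                fish

  -- Two small entries in decreasing order would form a 321 with `π₀` in front.
  small : ∀ {i j} → i Fin.< j → lookup π i Fin.< lookup π zero →
    lookup π j Fin.< lookup π zero → lookup π i Fin.< lookup π j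
  small {zero}      i<j i<0 j<0 = contradiction i<0 (ℕ.<-irrefl refl)
  small {suc i} {j} i<j i<0 j<0 with toℕ (lookup π (suc i)) ℕ.<? toℕ (lookup π j)
  ... | yes lt = lt
  ... | no ≮  = contradiction
    (zero , suc i , j , s≤s z≤n , i<j , i<0 , ≮⇒> i<j ≮) ¬321

  -- Two large entries in decreasing order would form a 2143 with `π₀` and the minimum at position 1
  -- in front. The cases where the left entry sits at position 0 or 1 are separate: `π₀` is the
  -- least large value, and the minimum is not large.
  large : ∀ {i j} → i Fin.< j → lookup π zero Fin.≤ lookup π i →
    lookup π zero Fin.≤ lookup π j → lookup π i Fin.< lookup π j
  large {i} {j} i<j 0≤i 0≤j with toℕ (lookup π i) ℕ.<? toℕ (lookup π j)
  ... | yes lt = lt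
  large {zero} i<j 0≤i 0≤j | no ≮ = contradiction (≮⇒> i<j ≮) (ℕ.≤⇒≯ 0≤j)
  large {suc zero} i<j 0≤i 0≤j | no ≮ =
    contradiction (ℕ.≤-trans 0≤i (ℕ.≤-reflexive (cong toℕ next≡0))) (ℕ.<⇒≱ 0<π₀)
  large {suc (suc i)} {j} i<j 0≤i 0≤j | no ≮ = contradiction
    (zero , suc zero , suc (suc i) , j , s≤s z≤n , s≤s (s≤s z≤n) , i<j ,
     ℕ.≤-<-trans (ℕ.≤-reflexive (cong toℕ next≡0)) 0<π₀ ,
     ℕ.≤∧≢⇒< 0≤j (λ e → ℕ.n≮0 (subst (λ k → suc (suc (toℕ i)) < toℕ k) (sym (inj (Fin.toℕ-injective e))) i<j)) ,
     ≮⇒> i<j ≮)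
    ¬2143

-- Everything follows from `descent`: a weak decrease can only lead from the large run to the small
-- one. Distinctness is a special case, since equal entries would lie in the same run.
TwoRuns⇒InF : {π : Word (2 ℕ.+ p)} → TwoRuns π → InF π
TwoRuns⇒InF {π = π} tr =
  inj , fish , Equivalence.from (avoids321 π) ¬321 , Equivalence.from (avoids2143 π) ¬2143
  where
  open TwoRuns tr

  split : ∀ i → lookup π i Fin.< lookup π zero ⊎ lookup π zero Fin.≤ lookup π i
  split i = ℕ.<-≤-connex _ _

  descent : ∀ {i j} → i Fin.< j → lookup π j Fin.≤ lookup π i →
            lookup π zero Fin.≤ lookup π i × lookup π j Fin.< lookup π zero
  descent {i} {j} i<j j≤i with split i | split j
  ... | inj₁ i↓ | inj₁ j↓ = contradiction (small-increasing i<j i↓ j↓) (ℕ.≤⇒≯ j≤i)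
  ... | inj₁ i↓ | inj₂ j↑ = contradiction (ℕ.<-≤-trans i↓ j↑) (ℕ.≤⇒≯ j≤i)
  ... | inj₂ i↑ | inj₁ j↓ = i↑ , j↓
  ... | inj₂ i↑ | inj₂ j↑ = contradiction (large-increasing i<j i↑ j↑) (ℕ.≤⇒≯ j≤i)

  ≢-of-< : ∀ {i j} → i Fin.< j → lookup π i ≢ lookup π j
  ≢-of-< i<j eq with i↑ , j↓ ← descent i<j (ℕ.≤-reflexive (cong toℕ (sym eq))) =
    ℕ.<⇒≱ j↓ (ℕ.≤-trans i↑ (ℕ.≤-reflexive (cong toℕ eq)))

  inj : IsPermutation π
  inj {i} {j} eq with Fin.<-cmp i j
  ... | tri< i<j _ _ = contradiction eq (≢-of-< i<j)
  ... | tri≈ _ i≡j _ = i≡j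
  ... | tri> _ _ j<i = contradiction (sym eq) (≢-of-< j<i)

  -- `π_i` is large and `π_i - 1` is small, so `π_i` is the threshold `π₀` and `i` is 0. But the
  -- entry after `π₀` is the minimum, not a larger value.
  fish : IsFishburn π
  fish (i , j , k , i∼j , j<k , k∼i , i<j)
    with i↑ , k↓ ← descent (ℕ.<-trans (ℕ.≤-reflexive (sym i∼j)) j<k)
                     (ℕ.≤-trans (ℕ.n≤1+n _) (ℕ.≤-reflexive (sym k∼i)))
    with inj {i} {zero} (Fin.toℕ-injective (ℕ.≤-antisym (ℕ.≤-trans (ℕ.≤-reflexive k∼i) k↓) i↑))
  fish (zero , suc zero , k , i∼j , j<k , k∼i , i<j) | refl =
    ℕ.n≮0 (ℕ.<-≤-trans i<j (ℕ.≤-reflexive (cong toℕ next≡0)))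

  -- The middle entry would be small, as the lower end of one descent, and large, as the upper end
  -- of the other.
  ¬321 : ¬ Contains321 π
  ¬321 (i , j , k , i<j , j<k , j↓i , k↓j) =
    ℕ.<⇒≱ (proj₂ (descent i<j (ℕ.<⇒≤ j↓i))) (proj₁ (descent j<k (ℕ.<⇒≤ k↓j)))

  -- The entry playing 2 is large and the one playing 3 is small, although 2 < 3.
  ¬2143 : ¬ Contains2143 π
  ¬2143 (i , j , k , l , i<j , j<k , k<l , j↓i , i↓l , l↓k) =
    ℕ.<⇒≱ (proj₂ (descent k<l (ℕ.<⇒≤ l↓k)))
      (ℕ.≤-trans (proj₁ (descent i<j (ℕ.<⇒≤ j↓i))) (ℕ.<⇒≤ i↓l))

-- Merges of two increasing runs

# : Bool → Vec Bool n → ℕ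
# b = Vec.count (Bool._≟ b)

#-sum : (c : Vec Bool n) → # true c ℕ.+ # false c ≡ n
#-sum []          = refl
#-sum (true ∷ c)  = cong suc (#-sum c)
#-sum (false ∷ c) = trans (ℕ.+-suc _ _) (cong suc (#-sum c))

bump : Bool → (Bool → ℕ) → Bool → ℕ
bump b next b′ = if does (b Bool.≟ b′) then suc (next b′) else next b′

-- The values false and true each stand for an increasing run; next b is the
-- value to be used at the next occurrence of b.
val : Vec Bool n → (Bool → ℕ) → Fin n → ℕ
val (b ∷ c) next zero    = next b
val (b ∷ c) next (suc i) = val c (bump b next) i

bump-≡ : ∀ b next → bump b next b ≡ suc (next b)
bump-≡ true  _ = refl
bump-≡ false _ = refl

next≤bump : ∀ b b′ next → next b′ ≤ bump b next b′
next≤bump true  true  _ = ℕ.n≤1+n _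
next≤bump true  false _ = ℕ.≤-refl
next≤bump false true  _ = ℕ.≤-refl
next≤bump false false _ = ℕ.n≤1+n _

-- The invariant behind the inductions over a word: the next value of a run plus the number of its
-- letters still to come is the fixed upper end of that run.
bump-+-# : ∀ b b′ next (c : Vec Bool n) →
           bump b next b′ ℕ.+ # b′ c ≡ next b′ ℕ.+ # b′ (b ∷ c)
bump-+-# true  true  _ c = sym (ℕ.+-suc _ _)
bump-+-# true  false _ c = refl
bump-+-# false true  _ c = refl
bump-+-# false false _ c = sym (ℕ.+-suc _ _)

next≤val : (c : Vec Bool n) {next : Bool → ℕ} (i : Fin n) →
           next (lookup c i) ≤ val c next i
next≤val (b ∷ c) zero    = ℕ.≤-refl
next≤val (b ∷ c) {next} (suc i) =
  ℕ.≤-trans (next≤bump b (lookup c i) next) (next≤val c i)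

val< : (c : Vec Bool n) {next : Bool → ℕ} (i : Fin n) →
       val c next i < next (lookup c i) ℕ.+ # (lookup c i) c
val< (b ∷ c) {next} zero    = subst (next b <_) (bump-+-# b b next c)
  (ℕ.<-≤-trans (ℕ.≤-reflexive (sym (bump-≡ b next))) (ℕ.m≤m+n _ _))
val< (b ∷ c) {next} (suc i) = 
  subst (val c (bump b next) i <_) (bump-+-# b (lookup c i) next c) (val< c i)

val-increasing : (c : Vec Bool n) {next : Bool → ℕ} {i j : Fin n} → i Fin.< j →
                 lookup c i ≡ lookup c j → val c next i < val c next j
val-increasing (b ∷ c) {next} {zero} {suc j} _ refl =
  ℕ.<-≤-trans (ℕ.≤-reflexive (sym (bump-≡ b next))) (next≤val c j)
val-increasing (b ∷ c) {i = suc i} {suc j} (s≤s i<j) eq = val-increasing c i<j eq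

-- If the entries of each class b are increasing and fill the interval from
-- next b to top b, then they are the values assigned by val.
val-unique : (class : ℕ → Bool) (top : Bool → ℕ) (next : Bool → ℕ) (v : Vec ℕ n) →
  (∀ b → next b ≤ top b) →
  (∀ i → next (class (lookup v i)) ≤ lookup v i × lookup v i < top (class (lookup v i))) →
  (∀ b z → next b ≤ z → z < top b → class z ≡ b × ∃ λ i → lookup v i ≡ z) →
  (∀ {i j} → i Fin.< j → class (lookup v i) ≡ class (lookup v j) → lookup v i < lookup v j) →
  (∀ b → next b ℕ.+ # b (Vec.map class v) ≡ top b) ×
  (∀ i → val (Vec.map class v) next i ≡ lookup v i)
val-unique class top next [] next≤top _ hits _ =
  (λ b → trans (ℕ.+-identityʳ _) (ℕ.≤-antisym (next≤top b)
    (ℕ.≮⇒≥ λ lt → Fin.¬Fin0 (proj₁ (proj₂ (hits b (next b) ℕ.≤-refl lt)))))) ,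
  λ ()
val-unique {n = suc n} class top next (x ∷ v) next≤top range hits incr =
  (λ b′ → trans (sym (bump-+-# b b′ next (Vec.map class v))) (proj₁ rec b′)) ,
  λ { zero → next≡x ; (suc i) → proj₂ rec i }
  where
  b = class x

  -- The value `next b` has to occur. At a later position it would be a smaller entry of the class
  -- of `x` standing to its right, against monotonicity.
  next≡x : next b ≡ x
  next≡x with ℕ.m≤n⇒m<n∨m≡n (proj₁ (range zero))
  ... | inj₂ eq = eq
  ... | inj₁ lt with hits b (next b) ℕ.≤-refl (ℕ.<-trans lt (proj₂ (range zero)))
  ...   | _ , zero , eq  = sym eq
  ...   | c≡b , suc i , eq = contradiction
    (incr {zero} {suc i} (s≤s z≤n) (trans (sym c≡b) (cong class (sym eq))))
    (ℕ.<-asym (subst (_< x) (sym eq) lt))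

  bump-cases : ∀ b′ {z} → (b ≡ b′ → suc (next b′) ≤ z) → next b′ ≤ z → bump b next b′ ≤ z
  bump-cases b′ same other with b Bool.≟ b′
  ... | yes eq = same eq
  ... | no  _  = other

  next≤top′ : ∀ b′ → bump b next b′ ≤ top b′
  next≤top′ b′ = bump-cases b′
    (λ { refl → subst (_< top b) (sym next≡x) (proj₂ (range zero)) }) (next≤top b′)

  range′ : ∀ i → bump b next (class (lookup v i)) ≤ lookup v i ×
                 lookup v i < top (class (lookup v i))
  range′ i = bump-cases (class (lookup v i))
    (λ eq → subst (_< lookup v i) (trans (sym next≡x) (cong next eq))
      (incr {zero} {suc i} (s≤s z≤n) eq))
    (proj₁ (range (suc i))) , proj₂ (range (suc i))

  hits′ : ∀ b′ z → bump b next b′ ≤ z → z < top b′ → class z ≡ b′ × ∃ λ i → lookup v i ≡ z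
  hits′ b′ z ≤z z< with hits b′ z (ℕ.≤-trans (next≤bump b b′ next) ≤z) z<
  ... | c≡b′ , suc i , eq = c≡b′ , i , eq
  ... | refl , zero , refl = contradiction
    (subst₂ _≤_ (bump-≡ b next) (sym next≡x) ≤z) (ℕ.<-irrefl refl)

  rec = val-unique class top (bump b next) v next≤top′ range′ hits′
          λ {i} {j} i<j → incr {suc i} {suc j} (s≤s i<j)

-- The runs split the values at the number of small letters, so every small value lies below every
-- large one.
start : Vec Bool n → Bool → ℕ
start c false = 0
start c true  = # false c

start-+-#≤n : (c : Vec Bool n) (b : Bool) → start c b ℕ.+ # b c ≤ n
start-+-#≤n c true  = ℕ.≤-reflexive (trans (ℕ.+-comm (# false c) _) (#-sum c))
start-+-#≤n c false = ℕ.≤-trans (ℕ.m≤n+m _ (# true c)) (ℕ.≤-reflexive (#-sum c))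

merge : Vec Bool n → Word n
merge c = Vec.tabulate λ i →
  fromℕ< (ℕ.<-≤-trans (val< c {start c} i) (start-+-#≤n c (lookup c i)))

toℕ-merge : (c : Vec Bool n) (i : Fin n) → toℕ (lookup (merge c) i) ≡ val c (start c) i
toℕ-merge c i = trans (cong toℕ (Vec.lookup∘tabulate _ i)) (Fin.toℕ-fromℕ< _)

merge-small : (c : Vec Bool n) (i : Fin n) → lookup c i ≡ false →
              toℕ (lookup (merge c) i) < # false c
merge-small c i eq with lookup c i | val< c {start c} i
... | false | lt = subst (_< # false c) (sym (toℕ-merge c i)) lt

merge-large : (c : Vec Bool n) (i : Fin n) → lookup c i ≡ true →
              # false c ≤ toℕ (lookup (merge c) i)
merge-large c i eq with lookup c i | next≤val c {start c} i
... | true | le = subst (# false c ≤_) (sym (toℕ-merge c i)) le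

merge-increasing : (c : Vec Bool n) {i j : Fin n} → i Fin.< j → lookup c i ≡ lookup c j →
                   lookup (merge c) i Fin.< lookup (merge c) j
merge-increasing c i<j eq =
  subst₂ _<_ (sym (toℕ-merge c _)) (sym (toℕ-merge c _)) (val-increasing c i<j eq)

merge-small⁻ : (c : Vec Bool n) (i : Fin n) → toℕ (lookup (merge c) i) < # false c →
               lookup c i ≡ false
merge-small⁻ c i lt = Bool.¬-not λ eq → ℕ.<⇒≱ lt (merge-large c i eq)

merge-large⁻ : (c : Vec Bool n) (i : Fin n) → # false c ≤ toℕ (lookup (merge c) i) →
               lookup c i ≡ true
merge-large⁻ c i ge = Bool.¬-not λ eq → ℕ.<⇒≱ (merge-small c i eq) ge

-- A letter is recovered by comparing the entry with the threshold `# false c`. The thresholds must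
-- agree: any word of small letters followed by large ones merges to the identity.
merge-injective : {c d : Vec Bool n} → # false c ≡ # false d → merge c ≡ merge d → c ≡ d
merge-injective {c = c} {d} #eq eq =
  trans (sym (Vec.tabulate∘lookup c)) (trans (Vec.tabulate-cong same) (Vec.tabulate∘lookup d))
  where
  same : ∀ i → lookup c i ≡ lookup d i
  same i with lookup c i in ci
  ... | true  = sym (merge-large⁻ d i (subst₂ (λ m π → m ≤ toℕ (lookup π i)) #eq eq (merge-large c i ci)))
  ... | false = sym (merge-small⁻ d i (subst₂ (λ m π → toℕ (lookup π i) < m) #eq eq (merge-small c i ci)))

-- These are the elements of F (2 + p) that do not start with their minimum.
peaked : Vec Bool p → Word (2 ℕ.+ p)
peaked c = merge (true ∷ false ∷ c)

-- The first letter is large and so receives the least large value. Hence the threshold between the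
-- runs can be read off the permutation, which makes `peaked` injective.
head-peaked : (c : Vec Bool p) → toℕ (lookup (peaked c) zero) ≡ suc (# false c)
head-peaked c = toℕ-merge (true ∷ false ∷ c) zero

peaked-TwoRuns : (c : Vec Bool p) → TwoRuns (peaked c)
peaked-TwoRuns c = record
  { head≢0 = λ eq → ℕ.1+n≢0 (trans (sym (head-peaked c)) (cong toℕ eq))
  ; next≡0 = Fin.toℕ-injective (toℕ-merge d (suc zero))
  ; small-increasing = λ {i} {j} i<j i↓ j↓ →
      merge-increasing d i<j (trans (small i i↓) (sym (small j j↓)))
  ; large-increasing = λ {i} {j} i<j i↑ j↑ →
      merge-increasing d i<j (trans (large i i↑) (sym (large j j↑)))
  }
  where
  d = true ∷ false ∷ c

  small : ∀ i → lookup (merge d) i Fin.< lookup (merge d) zero → lookup d i ≡ false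
  small i lt = merge-small⁻ d i (subst (toℕ (lookup (merge d) i) <_) (head-peaked c) lt)

  large : ∀ i → lookup (merge d) zero Fin.≤ lookup (merge d) i → lookup d i ≡ true
  large i ge = merge-large⁻ d i (subst (_≤ toℕ (lookup (merge d) i)) (head-peaked c) ge)

peaked-injective : {c d : Vec Bool p} → peaked c ≡ peaked d → c ≡ d
peaked-injective {c = c} {d} eq = Vec.∷-injectiveʳ (Vec.∷-injectiveʳ
  (merge-injective {c = true ∷ false ∷ c} {true ∷ false ∷ d}
    (trans (sym (head-peaked c)) (trans (cong (λ π → toℕ (lookup π zero)) eq) (head-peaked d))) eq))

-- The word is obtained by comparing each entry with `π₀`; `val-unique` then says that the entries
-- are those assigned by `val`.
TwoRuns⇒peaked : {π : Word (2 ℕ.+ p)} → TwoRuns π → ∃ λ c → π ≡ peaked c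
TwoRuns⇒peaked {p} {π} tr = c , trans (sym (Vec.tabulate∘lookup π))
    (trans (Vec.tabulate-cong λ i → Fin.toℕ-injective (same i)) (Vec.tabulate∘lookup (peaked c)))
  where
  open TwoRuns tr
  m = toℕ (lookup π zero)
  v = Vec.map toℕ π

  class : ℕ → Bool
  class z = does (m ℕ.≤? z)

  top : Bool → ℕ
  top true  = 2 ℕ.+ p
  top false = m

  next : Bool → ℕ
  next true  = m
  next false = 0

  class-large : ∀ {z} → m ≤ z → class z ≡ true
  class-large = dec-true (m ℕ.≤? _)

  class-small : ∀ {z} → z < m → class z ≡ false
  class-small z<m = dec-false (m ℕ.≤? _) (ℕ.<⇒≱ z<m)

  v≡π : ∀ i → lookup v i ≡ toℕ (lookup π i)
  v≡π i = Vec.lookup-map i toℕ π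

  π<2+p : ∀ i → toℕ (lookup π i) < 2 ℕ.+ p
  π<2+p i = Fin.toℕ<n (lookup π i)

  range : ∀ i → next (class (lookup v i)) ≤ lookup v i × lookup v i < top (class (lookup v i))
  range i rewrite v≡π i with ℕ.<-≤-connex (toℕ (lookup π i)) m
  ... | inj₁ lt rewrite class-small lt = z≤n , lt
  ... | inj₂ ge rewrite class-large ge = ge , π<2+p i

  hit : ∀ z → z < 2 ℕ.+ p → ∃ λ i → lookup v i ≡ z
  hit z z< with i , eq ← injective⇒surjective (proj₁ (TwoRuns⇒InF tr)) (fromℕ< z<) =
    i , trans (v≡π i) (trans (cong toℕ eq) (Fin.toℕ-fromℕ< z<))

  hits : ∀ b z → next b ≤ z → z < top b → class z ≡ b × ∃ λ i → lookup v i ≡ z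
  hits true  z m≤z z<  = class-large m≤z , hit z z<
  hits false z _   z<m = class-small z<m , hit z (ℕ.<-trans z<m (π<2+p zero))

  increasing : ∀ {i j} → i Fin.< j → class (lookup v i) ≡ class (lookup v j) →
               lookup v i < lookup v j
  increasing {i} {j} i<j eq rewrite v≡π i | v≡π j
    with ℕ.<-≤-connex (toℕ (lookup π i)) m | ℕ.<-≤-connex (toℕ (lookup π j)) m
  ... | inj₁ i↓ | inj₁ j↓ = small-increasing i<j i↓ j↓
  ... | inj₂ i↑ | inj₂ j↑ = large-increasing i<j i↑ j↑
  ... | inj₁ i↓ | inj₂ j↑ with () ← trans (sym (class-small i↓)) (trans eq (class-large j↑))
  ... | inj₂ i↑ | inj₁ j↓ with () ← trans (sym (class-large i↑)) (trans eq (class-small j↓))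

  next≤top : ∀ b → next b ≤ top b
  next≤top true  = ℕ.<⇒≤ (π<2+p zero)
  next≤top false = z≤n

  unique = val-unique class top next v next≤top range hits increasing

  d = Vec.map class v
  c = Vec.tail (Vec.tail d)

  d≡ : d ≡ true ∷ false ∷ c
  d≡ = trans (sym (Vec.tabulate∘lookup d)) (trans (Vec.tabulate-cong pointwise)
         (Vec.tabulate∘lookup (true ∷ false ∷ c)))
    where
    lookup-d : ∀ i → lookup d i ≡ class (toℕ (lookup π i))
    lookup-d i = trans (Vec.lookup-map i class v) (cong class (v≡π i))
    tails : ∀ {k} (w : Vec Bool (2 ℕ.+ k)) i →
            lookup w (suc (suc i)) ≡ lookup (Vec.tail (Vec.tail w)) i
    tails (_ ∷ _ ∷ w) i = refl
    pointwise : ∀ i → lookup d i ≡ lookup (true ∷ false ∷ c) i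
    pointwise zero          = trans (lookup-d zero) (class-large ℕ.≤-refl)
    pointwise (suc zero)    = trans (lookup-d (suc zero))
      (class-small (ℕ.≤-<-trans (ℕ.≤-reflexive (cong toℕ next≡0)) (≢zero⇒0< head≢0)))
    pointwise (suc (suc i)) = tails d i

  -- The count in `val-unique` shows that there are exactly `m` small letters, so `merge` also
  -- starts its large run at `m`.
  next≡start : ∀ b → next b ≡ start d b
  next≡start false = refl
  next≡start true  = sym (proj₁ unique false)

  val-cong : ∀ {k} (c : Vec Bool k) {f g : Bool → ℕ} → (∀ b → f b ≡ g b) →
             ∀ i → val c f i ≡ val c g i
  val-cong (b ∷ c) eq zero    = eq b
  val-cong (b ∷ c) eq (suc i) = val-cong c (λ b′ → cong (λ z → if does (b Bool.≟ b′) then suc z else z) (eq b′)) i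

  same : ∀ i → toℕ (lookup π i) ≡ toℕ (lookup (peaked c) i)
  same i = begin
    toℕ (lookup π i)          ≡⟨ v≡π i ⟨
    lookup v i                ≡⟨ proj₂ unique i ⟨
    val d next i              ≡⟨ val-cong d next≡start i ⟩
    val d (start d) i         ≡⟨ toℕ-merge d i ⟨
    toℕ (lookup (merge d) i)  ≡⟨ cong (λ d → toℕ (lookup (merge d) i)) d≡ ⟩
    toℕ (lookup (peaked c) i) ∎
    where open ≡-Reasoning

InF-cases : {π : Word (2 ℕ.+ p)} → InF π →
            (∃ λ σ → InF σ × π ≡ prepend σ) ⊎ (∃ λ c → π ≡ peaked c)
InF-cases {π = π} π∈F with lookup π zero Fin.≟ zero
... | yes π₀≡0 = inj₁ (starts-with-zero π∈F π₀≡0)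
... | no  π₀≢0 = inj₂ (TwoRuns⇒peaked (InF⇒TwoRuns π∈F π₀≢0))

peaked-InF : (c : Vec Bool p) → InF (peaked c)
peaked-InF c = TwoRuns⇒InF (peaked-TwoRuns c)

-- Labels

length-run : ∀ s m → List.length (run s m) ≡ m
length-run s m = List.length-applyUpTo (s ℕ.+_) m

run-∷ : ∀ s m → run s (suc m) ≡ s ∷ run (suc s) m
run-∷ s m = cong₂ _∷_ (ℕ.+-identityʳ s) (begin
  List.applyUpTo (λ i → s ℕ.+ suc i) m  ≡⟨ List.map-upTo _ m ⟨
  List.map (λ i → s ℕ.+ suc i) (List.upTo m)  ≡⟨ List.map-cong (ℕ.+-suc s) (List.upTo m) ⟩
  List.map (λ i → suc s ℕ.+ i) (List.upTo m)  ≡⟨ List.map-upTo _ m ⟩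
  run (suc s) m  ∎)
  where open ≡-Reasoning

map-suc-run : ∀ s m → List.map suc (run s m) ≡ run (suc s) m
map-suc-run s m = List.map-applyUpTo (s ℕ.+_) suc m

length-oneLine : (π : Word n) → List.length (oneLine π) ≡ n
length-oneLine π = trans (List.length-map _ (Vec.toList π)) (Vec.length-toList π)

EndsIn-length : {π : Word n} {xs : List ℕ} → EndsIn π xs → List.length xs ≤ n
EndsIn-length {π = π} {xs} e = subst (List.length xs ≤_) (length-oneLine π) (Suffix.length-mono e)

oneLine-prepend : (σ : Word n) → oneLine (prepend σ) ≡ 1 ∷ List.map suc (oneLine σ)
oneLine-prepend σ = cong (1 ∷_) (begin
  List.map (suc ∘ toℕ) (Vec.toList (Vec.map suc σ))       ≡⟨ cong (List.map (suc ∘ toℕ)) (Vec.toList-map suc σ) ⟩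
  List.map (suc ∘ toℕ) (List.map suc (Vec.toList σ))      ≡⟨ List.map-∘ (Vec.toList σ) ⟨
  List.map (λ x → suc (suc (toℕ x))) (Vec.toList σ)      ≡⟨ List.map-∘ (Vec.toList σ) ⟩
  List.map suc (oneLine σ)                                ∎)
  where open ≡-Reasoning

EndsIn-prepend : {σ : Word n} {xs : List ℕ} → EndsIn σ xs → EndsIn (prepend σ) (List.map suc xs)
EndsIn-prepend {σ = σ} e = subst (Suffix _≡_ _) (sym (oneLine-prepend σ))
  (there (Suffix.map⁺ suc suc (Suffix.map (cong suc) e)))

-- The suffix begins with an entry of at least 2, so it cannot reach back to the leading 1.
EndsIn-prepend⁻ : {σ : Word n} {x : ℕ} {xs : List ℕ} →
  EndsIn (prepend σ) (List.map suc (suc x ∷ xs)) → EndsIn σ (suc x ∷ xs)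
EndsIn-prepend⁻ {σ = σ} e with subst (Suffix _≡_ _) (oneLine-prepend σ) e
... | here (() ∷ _)
... | there s = Suffix.map ℕ.suc-injective (Suffix.map⁻ suc suc s)

label1a-prepend : {σ : Word (suc p)} → Label1a (prepend σ) ⇔ Label1a σ
label1a-prepend {p} {σ} = mk⇔ to from
  where
  to : Label1a (prepend σ) → Label1a σ
  to (_ , zero  , _     , _   , ())
  to (e , suc i , suc j , i∼j , d) =
    EndsIn-prepend⁻ {σ = σ} e , i , j , ℕ.suc-injective i∼j , prepend-<⁻ {σ = σ} {j} {i} d
  from : Label1a σ → Label1a (prepend σ)
  from (e , i , j , i∼j , d) =
    EndsIn-prepend {σ = σ} e , suc i , suc j , cong suc i∼j , prepend-< {σ = σ} {j} {i} d

second-in-suffix : ∀ {A : Set} {m x y xs} (f : A → ℕ) (v : Vec A m) →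
  Suffix _≡_ (x ∷ y ∷ xs) (List.map f (Vec.toList v)) →
  ∃ λ i → 0 < toℕ i × y ≡ f (lookup v i)
second-in-suffix f []          (here ())
second-in-suffix f (_ ∷ _ ∷ v) (here (_ ∷ eq ∷ _)) = suc zero , s≤s z≤n , eq
second-in-suffix f (_ ∷ v)     (there s) with i , _ , eq ← second-in-suffix f v s =
  suc i , s≤s z≤n , eq
second-in-suffix f (_ ∷ [])    (here (_ ∷ ()))

1-early : {σ : Word (2 ℕ.+ p)} → InF σ → ∀ {i} → lookup σ i ≡ zero → toℕ i ≤ 1
1-early {σ = σ} σ∈F@(inj , _) {i} σᵢ≡0 with lookup σ zero Fin.≟ zero
... | yes σ₀≡0 with refl ← inj {i} {zero} (trans σᵢ≡0 (sym σ₀≡0)) = z≤n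
... | no σ₀≢0 with refl ← inj {i} {suc zero}
  (trans σᵢ≡0 (sym (TwoRuns.next≡0 (InF⇒TwoRuns {π = σ} σ∈F σ₀≢0)))) = s≤s z≤n

-- As the suffix is proper, its second entry stands beyond the second position of `σ`, whereas 1
-- occurs at one of the first two.
¬ends-in-x1 : {σ : Word (2 ℕ.+ p)} → InF σ → ∀ {x xs} → 2 ℕ.+ List.length xs < 2 ℕ.+ p →
              ¬ EndsIn σ (x ∷ 1 ∷ xs)
¬ends-in-x1 {σ = y ∷ v} σ∈F short (here eqs) =
  ℕ.<-irrefl (trans (Pointwise.Pointwise-length eqs) (length-oneLine (y ∷ v))) short
¬ends-in-x1 {σ = y ∷ v} σ∈F short (there s) with second-in-suffix (suc ∘ toℕ) v s
... | i , 0<i , eq = ℕ.<⇒≱ (s≤s 0<i)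
  (1-early {σ = y ∷ v} σ∈F {suc i} (Fin.toℕ-injective (sym (ℕ.suc-injective eq))))

-- Deletion lowers n and `ℓ` by one together, so the only obstacle is the bound k - 1 < `ℓ`, which
-- fails for `σ` if `ℓ` was k. In that case `σ` would end in its maximum followed by 1, 2, ..., k -
-- 1, which `¬ends-in-x1` excludes.
label*-prepend : ∀ j → {σ : Word (suc p)} → InF σ → 1 ≤ j →
                 Label* (suc j) (prepend σ) ⇔ Label* (suc j) σ
label*-prepend {p} j@(suc i) {σ} σ∈F _ = mk⇔ to from
  where
  k N : ℕ
  k = suc j
  N = suc p

  ends-at-j : ∀ i → i ℕ.+ 2 ∸ suc i ≡ 1
  ends-at-j i = trans (cong (_∸ suc i) (ℕ.+-suc i 1)) (ℕ.m+n∸m≡n i 1)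

  shift : ∀ s m → suc N ∷ run (suc s) m ≡ List.map suc (N ∷ run s m)
  shift s m = cong (suc N ∷_) (sym (map-suc-run s m))

  start-suc : ∀ {ℓ} → j ≤ ℓ → suc ℓ ℕ.+ 2 ∸ k ≡ suc (ℓ ℕ.+ 2 ∸ k)
  start-suc {ℓ} j≤ℓ = ℕ.+-∸-assoc 1 {ℓ ℕ.+ 2} {k}
    (subst (k ≤_) (sym (ℕ.+-suc ℓ 1)) (s≤s (ℕ.≤-trans j≤ℓ (ℕ.m≤m+n ℓ 1))))

  shifted : ∀ {ℓ} → j ≤ ℓ → EndsIn (prepend σ) (suc N ∷ run (suc ℓ ℕ.+ 2 ∸ k) j) →
            EndsIn σ (N ∷ run (ℓ ℕ.+ 2 ∸ k) j)
  shifted {ℓ} j≤ℓ e = EndsIn-prepend⁻ {σ = σ} (subst (EndsIn (prepend σ))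
    (trans (cong (λ s → suc N ∷ run s j) (start-suc j≤ℓ)) (shift (ℓ ℕ.+ 2 ∸ k) j)) e)

  to : Label* k (prepend σ) → Label* k σ
  to (inj₁ e) = inj₁ (EndsIn-prepend⁻ {σ = σ} (subst (EndsIn (prepend σ)) eq e))
    where
    k≤N : k ≤ N
    k≤N = s≤s⁻¹ (subst (_≤ suc N) (cong suc (length-run _ k)) (EndsIn-length {π = prepend σ} e))
    eq : suc N ∷ run (suc N ∸ k) k ≡ List.map suc (N ∷ run (N ∸ k) k)
    eq = trans (cong (λ s → suc N ∷ run s k) (ℕ.+-∸-assoc 1 k≤N)) (shift (N ∸ k) k)
  to (inj₂ (2≤k , suc ℓ , s≤s ℓ<p , s≤s j≤ℓ , e)) with ℕ.m≤n⇒m<n∨m≡n j≤ℓ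
  ... | inj₁ j<ℓ  = inj₂ (2≤k , ℓ , ℓ<p , j<ℓ , shifted j≤ℓ e)
  ... | inj₂ refl with s≤s i<p ← ℓ<p = contradiction
    (subst (λ xs → EndsIn σ (N ∷ xs))
      (trans (cong (λ s → run s j) (ends-at-j i)) (run-∷ 1 i)) (shifted j≤ℓ e))
    (¬ends-in-x1 σ∈F (s≤s (s≤s (subst (_< _) (sym (length-run 2 i)) i<p))))

  from : Label* k σ → Label* k (prepend σ)
  from (inj₁ e) = inj₁ (subst (EndsIn (prepend σ)) (sym eq) (EndsIn-prepend {σ = σ} e))
    where
    k≤N : k ≤ N
    k≤N = ℕ.≤-trans (ℕ.n≤1+n k)
      (subst (_≤ N) (cong suc (length-run _ k)) (EndsIn-length {π = σ} e))
    eq : suc N ∷ run (suc N ∸ k) k ≡ List.map suc (N ∷ run (N ∸ k) k)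
    eq = trans (cong (λ s → suc N ∷ run s k) (ℕ.+-∸-assoc 1 k≤N)) (shift (N ∸ k) k)
  from (inj₂ (2≤k , ℓ , ℓ<p , j<ℓ , e)) = inj₂ (2≤k , suc ℓ , s≤s ℓ<p , s≤s (ℕ.<⇒≤ j<ℓ) ,
    subst (EndsIn (prepend σ))
      (sym (trans (cong (λ s → suc N ∷ run s j) (start-suc (ℕ.<⇒≤ j<ℓ))) (shift (ℓ ℕ.+ 2 ∸ k) j)))
      (EndsIn-prepend {σ = σ} e))

-- Labels of merged words

#true≡0 : (c : Vec Bool n) → # true c ≡ 0 → c ≡ replicate n false
#true≡0 []          _  = refl
#true≡0 (false ∷ c) eq = cong (false ∷_) (#true≡0 c eq)

#true-replicate : ∀ n → # true (replicate n false) ≡ 0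
#true-replicate zero    = refl
#true-replicate (suc n) = #true-replicate n

#false-replicate : ∀ n → # false (replicate n false) ≡ n
#false-replicate zero    = refl
#false-replicate (suc n) = cong suc (#false-replicate n)

val-replicate : ∀ n next → List.tabulate (val (replicate n false) next) ≡ run (next false) n
val-replicate zero    next = refl
val-replicate (suc n) next =
  trans (cong (next false ∷_) (val-replicate n (bump false next))) (sym (run-∷ (next false) n))

-- The last large letter has exactly `j` small letters after it. The length condition is an
-- equation, so that matching on words of length `m + suc j` leaves an equation that can be refuted.
data LastPeak (j : ℕ) : Vec Bool n → Set where
  here  : {c : Vec Bool n} → n ≡ j → c ≡ replicate n false → LastPeak j (true ∷ c)
  there : ∀ {b} {c : Vec Bool n} → LastPeak j c → LastPeak j (b ∷ c)

LastPeak-length : ∀ {j} {c : Vec Bool n} → LastPeak j c → j < n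
LastPeak-length (here refl _) = ℕ.n<1+n _
LastPeak-length (there l)     = ℕ.m<n⇒m<1+n (LastPeak-length l)

LastPeak-#true : ∀ {j} {c : Vec Bool n} → LastPeak j c → 0 < # true c
LastPeak-#true (here _ _)            = s≤s z≤n
LastPeak-#true (there {b = true}  l) = s≤s z≤n
LastPeak-#true (there {b = false} l) = LastPeak-#true l

LastPeak-#false : ∀ {j} {c : Vec Bool n} → LastPeak j c → j ≤ # false c
LastPeak-#false (here refl refl)      = ℕ.≤-reflexive (sym (#false-replicate _))
LastPeak-#false (there {b = true}  l) = LastPeak-#false l
LastPeak-#false (there {b = false} l) = ℕ.m≤n⇒m≤1+n (LastPeak-#false l)

LastPeak-++ : ∀ {j m} (c : Vec Bool m) → LastPeak j (c Vec.++ true ∷ replicate j false)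
LastPeak-++ []      = here refl refl
LastPeak-++ (b ∷ c) = there (LastPeak-++ c)

LastPeak-++⁻ : ∀ {j} m {c : Vec Bool (m ℕ.+ suc j)} → LastPeak j c →
               ∃ λ d → c ≡ d Vec.++ true ∷ replicate j false
LastPeak-++⁻ zero    (here _ refl)  = [] , refl
LastPeak-++⁻ zero    (there l)      = contradiction (LastPeak-length l) (ℕ.<-irrefl refl)
LastPeak-++⁻ (suc m) (here eq _)    = contradiction eq (ℕ.m+1+n≢n m)
LastPeak-++⁻ (suc m) (there {b = b} l) with d , eq ← LastPeak-++⁻ m l = b ∷ d , cong (b ∷_) eq

-- The two hypotheses say that `N` is the last value of the large run and that all small values lie
-- below it. So `N` marks a large letter, and no large letter follows. The suffix then lists the end
-- of the small run, which determines `r` as soon as the list after `N` is nonempty.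
suffix⇒LastPeak : ∀ (c : Vec Bool n) next N r j →
  next true ℕ.+ # true c ≡ suc N → next false ℕ.+ # false c ≤ N →
  Suffix _≡_ (N ∷ run r j) (List.tabulate (val c next)) →
  LastPeak j c × (0 < j → r ℕ.+ j ≡ next false ℕ.+ # false c)
suffix⇒LastPeak [] next N r j _ _ (here ())
suffix⇒LastPeak (b ∷ c) next N r j t f (there s) =
  let l , eq = suffix⇒LastPeak c (bump b next) N r j
                 (trans (bump-+-# b true next c) t)
                 (ℕ.≤-trans (ℕ.≤-reflexive (bump-+-# b false next c)) f) s
  in there l , λ 0<j → trans (eq 0<j) (bump-+-# b false next c)
suffix⇒LastPeak (false ∷ c) next N r j t f (here (refl ∷ _)) =
  contradiction (s≤s (ℕ.m≤m+n N _)) (ℕ.≤⇒≯ (ℕ.≤-trans (ℕ.≤-reflexive (sym (ℕ.+-suc N _))) f))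
suffix⇒LastPeak {suc n} (true ∷ c) next N r j t f (here (refl ∷ eqs))
  with refl ← #true≡0 c (ℕ.+-cancelˡ-≡ N _ 0 (ℕ.suc-injective
                (trans (sym (ℕ.+-suc N _)) (trans t (cong suc (sym (ℕ.+-identityʳ N)))))))
  with refl ← trans (sym (length-run r j))
                (trans (Pointwise.Pointwise-length eqs) (List.length-tabulate (val c (bump true next))))
  = here refl refl , λ 0<n → cong₂ ℕ._+_ (first n 0<n eqs) (sym (#false-replicate n))
  where
  first : ∀ n → 0 < n →
    Pointwise _≡_ (run r n) (List.tabulate (val (replicate n false) (bump true next))) →
    r ≡ next false
  first (suc n) _ (eq ∷ _) = trans (sym (ℕ.+-identityʳ r)) eq

LastPeak⇒suffix : ∀ {c : Vec Bool n} next N r j →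
  next true ℕ.+ # true c ≡ suc N → r ℕ.+ j ≡ next false ℕ.+ # false c →
  LastPeak j c → Suffix _≡_ (N ∷ run r j) (List.tabulate (val c next))
LastPeak⇒suffix next N r j t f (there {b = b} {c} l) = there (LastPeak⇒suffix (bump b next) N r j
  (trans (bump-+-# b true next c) t) (trans f (sym (bump-+-# b false next c))) l)
LastPeak⇒suffix next N r j t f (here {c = c} refl refl)
  with refl ← ℕ.+-cancelʳ-≡ j r (next false)
                (trans f (cong (next false ℕ.+_) (#false-replicate j)))
  = here (Pointwise.≡⇒Pointwise-≡ (cong₂ _∷_ N≡ (sym (val-replicate j (bump true next)))))
  where
  N≡ : N ≡ next true
  N≡ = ℕ.suc-injective (trans (sym t) (trans (cong (λ z → next true ℕ.+ suc z) (#true-replicate j))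
    (ℕ.+-comm (next true) 1)))

oneLine-tabulate : (π : Word n) → oneLine π ≡ List.tabulate (λ i → suc (toℕ (lookup π i)))
oneLine-tabulate = go
  where
  go : ∀ {m n} (v : Vec (Fin m) n) →
       List.map (λ x → suc (toℕ x)) (Vec.toList v) ≡ List.tabulate (λ i → suc (toℕ (lookup v i)))
  go []      = refl
  go (x ∷ v) = cong (_ ∷_) (go v)

val-suc : ∀ (c : Vec Bool n) {f g} → (∀ b → f b ≡ suc (g b)) → ∀ i → val c f i ≡ suc (val c g i)
val-suc (b ∷ c) eq zero    = eq b
val-suc (b ∷ c) {f} {g} eq (suc i) = val-suc c bumped i
  where
  bumped : ∀ b′ → bump b f b′ ≡ suc (bump b g b′)
  bumped b′ with b Bool.≟ b′
  ... | yes _ = cong suc (eq b′)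
  ... | no  _ = eq b′

oneLine-merge : (c : Vec Bool n) → oneLine (merge c) ≡ List.tabulate (val c (suc ∘ start c))
oneLine-merge c = trans (oneLine-tabulate (merge c)) (List.tabulate-cong λ i →
  trans (cong suc (toℕ-merge c i)) (sym (val-suc c (λ _ → refl) i)))

module _ (c : Vec Bool p) where
  private
    d : Vec Bool (2 ℕ.+ p)
    d = true ∷ false ∷ c

    values : suc (# false d) ℕ.+ # true d ≡ suc (2 ℕ.+ p)
    values = cong suc (trans (ℕ.+-comm _ (# true d)) (#-sum d))

    #false≤ : # false d ≤ suc p
    #false≤ = s≤s (ℕ.≤-trans (ℕ.m≤n+m _ (# true c)) (ℕ.≤-reflexive (#-sum c)))

  peaked-EndsIn : ∀ r j → EndsIn (peaked c) (2 ℕ.+ p ∷ run r j) →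
    LastPeak j d × (0 < j → r ℕ.+ j ≡ 2 ℕ.+ # false c)
  peaked-EndsIn r j e = suffix⇒LastPeak d (suc ∘ start d) (2 ℕ.+ p) r j
    values (s≤s #false≤) (subst (Suffix _≡_ _) (oneLine-merge d) e)

  peaked-EndsIn⁻ : ∀ r j → LastPeak j d → r ℕ.+ j ≡ 2 ℕ.+ # false c →
    EndsIn (peaked c) (2 ℕ.+ p ∷ run r j)
  peaked-EndsIn⁻ r j l eq = subst (Suffix _≡_ _) (sym (oneLine-merge d))
    (LastPeak⇒suffix (suc ∘ start d) (2 ℕ.+ p) r j values eq l)

  peaked-HasDescent : HasDescent (peaked c)
  peaked-HasDescent = zero , suc zero , refl ,
    subst₂ _<_ (sym (cong toℕ next≡0)) (sym (head-peaked c)) (s≤s z≤n)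
    where open TwoRuns (peaked-TwoRuns c)

  -- The first two entries always form a descent, so the label only asks that the last letter be
  -- large.
  label1a-peaked : Label1a (peaked c) ⇔ LastPeak 0 c
  label1a-peaked = mk⇔ to from
    where
    to : Label1a (peaked c) → LastPeak 0 c
    to (e , _) with peaked-EndsIn 0 0 e
    ... | there (there l) , _ = l
    from : LastPeak 0 c → Label1a (peaked c)
    from l = peaked-EndsIn⁻ (2 ℕ.+ # false c) 0 (there (there l)) (ℕ.+-identityʳ _) ,
             peaked-HasDescent

  -- In the first alternative of the label, n-1 is the last small value, so n is the only large one;
  -- it then comes first and `c` has no large letter. In the second, n comes from a large letter of
  -- `c`.
  label*-peaked : ∀ j → 1 ≤ j →
    Label* (suc j) (peaked c) ⇔ (p ≡ j × c ≡ replicate p false ⊎ LastPeak j c)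
  label*-peaked j 1≤j = mk⇔ to from
    where
    k : ℕ
    k = suc j

    #false<p : ∀ {j} → LastPeak j c → # false c < p
    #false<p l = subst (# false c <_) (#-sum c) (ℕ.m<n+m (# false c) (LastPeak-#true l))

    to : Label* k (peaked c) → p ≡ j × c ≡ replicate p false ⊎ LastPeak j c
    to (inj₁ e) with peaked-EndsIn (2 ℕ.+ p ∸ k) k e
    ... | here refl refl , _ = inj₁ (refl , refl)
    ... | there (there l) , eq = contradiction (#false<p l)
      (ℕ.<-irrefl (ℕ.+-cancelˡ-≡ 2 _ p (trans (sym (eq (s≤s z≤n)))
        (ℕ.m∸n+n≡m (ℕ.<⇒≤ (ℕ.m<n⇒m<1+n (ℕ.m<n⇒m<1+n (LastPeak-length l))))))))
    to (inj₂ (_ , ℓ , ℓ<1+p , j<ℓ , e)) with peaked-EndsIn (ℓ ℕ.+ 2 ∸ k) j e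
    ... | here refl _ , _ = contradiction ℓ<1+p (ℕ.<-asym j<ℓ)
    ... | there (there l) , _ = inj₂ l

    from : p ≡ j × c ≡ replicate p false ⊎ LastPeak j c → Label* k (peaked c)
    from (inj₁ (refl , refl)) = inj₁ (peaked-EndsIn⁻ (2 ℕ.+ p ∸ k) k (here refl refl)
      (trans (cong (ℕ._+ k) (ℕ.m+n∸n≡m 1 k)) (cong (2 ℕ.+_) (sym (#false-replicate p)))))
    -- `ℓ` is the largest small value in one-line notation: `c` has `# false c` small letters and
    -- the second letter of the whole word is one more.
    from (inj₂ l) = inj₂ (s≤s 1≤j , suc (# false c) , s≤s (#false<p l) , s≤s (LastPeak-#false l) ,
      peaked-EndsIn⁻ (suc (# false c) ℕ.+ 2 ∸ k) j (there (there l)) eq)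
      where
      eq : (# false c ℕ.+ 2 ∸ j) ℕ.+ j ≡ 2 ℕ.+ # false c
      eq = trans (ℕ.m∸n+n≡m (ℕ.≤-trans (LastPeak-#false l) (ℕ.m≤m+n _ 2))) (ℕ.+-comm _ 2)

-- Enumerations of F(321,2143)

-- Lists enumerating equivalent predicates are permutations of each other, so a sum over a filtered
-- `F n` may be taken over any convenient enumeration instead.
record Enumerates {A : Set} {ℓ} (P : Pred A ℓ) (xs : List A) : Set ℓ where
  field
    unique : Unique xs
    member : ∀ x → x ∈ xs ⇔ P x

open Enumerates

Enumerates-[] : ∀ {A : Set} {ℓ} {P : Pred A ℓ} → (∀ x → ¬ P x) → Enumerates P []
Enumerates-[] ¬P .unique   = []
Enumerates-[] ¬P .member x = mk⇔ (λ ()) (λ Px → contradiction Px (¬P x))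

Enumerates-filter : ∀ {A : Set} {ℓ₁ ℓ₂} {P : Pred A ℓ₁} {Q : Pred A ℓ₂} {xs} (Q? : Decidable Q) →
  Enumerates P xs → Enumerates (P ∩ Q) (filter Q? xs)
Enumerates-filter Q? e .unique = Unique.filter⁺ Q? (unique e)
Enumerates-filter {xs = xs} Q? e .member x = mk⇔
  (λ x∈ → let x∈xs , Qx = ∈-filter⁻ Q? {xs = xs} x∈ in Equivalence.to (member e x) x∈xs , Qx)
  (λ (Px , Qx) → ∈-filter⁺ Q? (Equivalence.from (member e x) Px) Qx)

Enumerates-↭ : ∀ {A : Set} {ℓ₁ ℓ₂} {P : Pred A ℓ₁} {Q : Pred A ℓ₂} {xs ys} →
  Enumerates P xs → Enumerates Q ys → (∀ x → P x ⇔ Q x) → xs ↭ ys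
Enumerates-↭ e f P⇔Q = ∼bag⇒↭ (unique∧set⇒bag (unique e) (unique f) λ {x} → mk⇔
  (Equivalence.from (member f x) ∘ Equivalence.to (P⇔Q x) ∘ Equivalence.to (member e x))
  (Equivalence.from (member e x) ∘ Equivalence.from (P⇔Q x) ∘ Equivalence.to (member f x)))

Enumerates-map : ∀ {A B : Set} {ℓ} {P : Pred A ℓ} {xs} {f : A → B} →
  (∀ {x y} → f x ≡ f y → x ≡ y) → Enumerates P xs →
  Enumerates (λ z → ∃ λ x → P x × z ≡ f x) (List.map f xs)
Enumerates-map inj e .unique = Unique.map⁺ inj (unique e)
Enumerates-map {f = f} inj e .member z = mk⇔
  (λ z∈ → let x , x∈ , eq = ∈-map⁻ f z∈ in x , Equivalence.to (member e x) x∈ , eq)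
  (λ { (x , Px , refl) → ∈-map⁺ f (Equivalence.from (member e x) Px) })

Enumerates-++ : ∀ {A : Set} {ℓ₁ ℓ₂} {P : Pred A ℓ₁} {Q : Pred A ℓ₂} {xs ys} →
  (∀ {x} → P x → ¬ Q x) → Enumerates P xs → Enumerates Q ys → Enumerates (P ∪ Q) (xs ++ ys)
Enumerates-++ disjoint e f .unique = Unique.++⁺ (unique e) (unique f)
  λ {x} (∈l , ∈r) → disjoint (Equivalence.to (member e x) ∈l) (Equivalence.to (member f x) ∈r)
Enumerates-++ {xs = xs} disjoint e f .member x = mk⇔
  (Sum.map (Equivalence.to (member e x)) (Equivalence.to (member f x)) ∘ ∈-++⁻ xs)
  Sum.[ ∈-++⁺ˡ ∘ Equivalence.from (member e x) , ∈-++⁺ʳ xs ∘ Equivalence.from (member f x) ]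

Enumerates-⇔ : ∀ {A : Set} {ℓ₁ ℓ₂} {P : Pred A ℓ₁} {Q : Pred A ℓ₂} {xs} →
  (∀ x → P x ⇔ Q x) → Enumerates P xs → Enumerates Q xs
Enumerates-⇔ P⇔Q e .unique   = unique e
Enumerates-⇔ P⇔Q e .member x = P⇔Q x ⇔-∘ member e x

bits : ∀ p → List (Vec Bool p)
bits zero    = [] ∷ []
bits (suc p) = List.map (true ∷_) (bits p) ++ List.map (false ∷_) (bits p)

Enumerates-bits : ∀ p → Enumerates U (bits p)
Enumerates-bits zero .unique    = [] ∷ []
Enumerates-bits zero .member [] = mk⇔ _ (λ _ → here refl)
Enumerates-bits (suc p) = Enumerates-⇔ (λ c → mk⇔ _ (λ _ → head c))
  (Enumerates-++ (λ { (_ , _ , refl) (_ , _ , ()) })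
    (Enumerates-map Vec.∷-injectiveʳ (Enumerates-bits p))
    (Enumerates-map Vec.∷-injectiveʳ (Enumerates-bits p)))
  where
  head : (c : Vec Bool (suc p)) → (∃ λ d → U d × c ≡ true ∷ d) ⊎ (∃ λ d → U d × c ≡ false ∷ d)
  head (true  ∷ d) = inj₁ (d , _ , refl)
  head (false ∷ d) = inj₂ (d , _ , refl)

peaks : ∀ r j → List (Vec Bool (r ℕ.+ suc j))
peaks r j = List.map (Vec._++ true ∷ replicate j false) (bits r)

Enumerates-peaks : ∀ r j → Enumerates (LastPeak j) (peaks r j)
Enumerates-peaks r j = Enumerates-⇔ (λ c → mk⇔ (to c) from)
  (Enumerates-map (λ {c} {d} → Vec.++-injectiveˡ c d) (Enumerates-bits r))
  where
  to : ∀ c → (∃ λ d → U d × c ≡ d Vec.++ true ∷ replicate j false) → LastPeak j c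
  to _ (d , _ , refl) = LastPeak-++ d
  from : ∀ {c} → LastPeak j c → ∃ λ d → U d × c ≡ d Vec.++ true ∷ replicate j false
  from l with d , eq ← LastPeak-++⁻ r l = d , _ , eq

#true-++ : ∀ {r} j (c : Vec Bool r) → # true (c Vec.++ true ∷ replicate j false) ≡ suc (# true c)
#true-++ j []          = cong suc (#true-replicate j)
#true-++ j (true  ∷ c) = cong suc (#true-++ j c)
#true-++ j (false ∷ c) = #true-++ j c

Enumerates-F : ∀ n → Enumerates InF (F n)
Enumerates-F n = Enumerates-⇔ (λ π → mk⇔ proj₂ (_ ,_))
  (Enumerates-filter inF? all)
  where
  all : Enumerates U (vectors n n)
  all .unique   = vectors-unique n n
  all .member π = mk⇔ _ (λ _ → vectors-complete π)

-- A single form for all three generating functions: `P` is `U`, `Label1a` or `Label* k`. The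
-- classes are disjoint because only one of them has a first entry of zero.
decomposition : ∀ {ℓ₁ ℓ₂ ℓ₃}
  {P : Pred (Word (2 ℕ.+ p)) ℓ₁} {Q : Pred (Word (1 ℕ.+ p)) ℓ₂} {R : Pred (Vec Bool p) ℓ₃}
  {xs ys cs} → Enumerates (InF ∩ P) xs → Enumerates (InF ∩ Q) ys → Enumerates R cs →
  (∀ σ → InF σ → P (prepend σ) ⇔ Q σ) → (∀ c → P (peaked c) ⇔ R c) →
  xs ↭ List.map prepend ys ++ List.map peaked cs
decomposition {p} {P = P} {Q} {R} ex ey ec P⇔Q P⇔R = Enumerates-↭ ex
  (Enumerates-++ disjoint (Enumerates-map prepend-injective ey) (Enumerates-map peaked-injective ec))
  λ π → mk⇔ (to π) (from π)
  where
  Left Right : Pred (Word (2 ℕ.+ p)) _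
  Left  π = ∃ λ σ → (InF σ × Q σ) × π ≡ prepend σ
  Right π = ∃ λ c → R c × π ≡ peaked c

  disjoint : ∀ {π} → Left π → ¬ Right π
  disjoint (σ , _ , refl) (c , _ , eq) =
    TwoRuns.head≢0 (peaked-TwoRuns c) (sym (cong (λ π → lookup π zero) eq))

  to : ∀ π → InF π × P π → Left π ⊎ Right π
  to π (π∈F , Pπ) with InF-cases {π = π} π∈F
  ... | inj₁ (σ , σ∈F , refl) = inj₁ (σ , (σ∈F , Equivalence.to (P⇔Q σ σ∈F) Pπ) , refl)
  ... | inj₂ (c , refl)       = inj₂ (c , Equivalence.to (P⇔R c) Pπ , refl)

  from : ∀ π → Left π ⊎ Right π → InF π × P π
  from _ (inj₁ (σ , (σ∈F , Qσ) , refl)) =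
    prepend-InF {σ = σ} σ∈F , Equivalence.from (P⇔Q σ σ∈F) Qσ
  from _ (inj₂ (c , Rc , refl)) = peaked-InF c , Equivalence.from (P⇔R c) Rc

-- Left-to-right maxima in the two classes

length-filter-tabulate : ∀ {A B : Set} {ℓ₁ ℓ₂} {P : Pred A ℓ₁} {Q : Pred B ℓ₂}
  (P? : Decidable P) (Q? : Decidable Q) {f : Fin n → A} {g : Fin n → B} →
  (∀ i → P (f i) ⇔ Q (g i)) →
  List.length (filter P? (List.tabulate f)) ≡ List.length (filter Q? (List.tabulate g))
length-filter-tabulate {zero}  P? Q?         _   = refl
length-filter-tabulate {suc n} P? Q? {f} {g} P⇔Q
  with ih ← length-filter-tabulate P? Q? (P⇔Q ∘ suc) | P? (f zero) | Q? (g zero)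
... | yes _  | yes _  = cong suc ih
... | no  _  | no  _  = ih
... | yes pf | no ¬qg = contradiction (Equivalence.to (P⇔Q zero) pf) ¬qg
... | no ¬pf | yes qg = contradiction (Equivalence.from (P⇔Q zero) qg) ¬pf

#-filter : ∀ b (c : Vec Bool n) → # b c ≡ List.length (filter (Bool._≟ b) (List.tabulate (lookup c)))
#-filter b []      = refl
#-filter b (x ∷ c) with does (x Bool.≟ b)
... | true  = cong suc (#-filter b c)
... | false = #-filter b c

lrmax-prepend : (σ : Word n) → lrmax (prepend σ) ≡ suc (lrmax σ)
lrmax-prepend {n} σ = trans
  (cong List.length (List.filter-accept (isLRMax? (prepend σ)) {zero} {List.tabulate suc} λ _ ()))
  (cong suc (length-filter-tabulate (isLRMax? (prepend σ)) (isLRMax? σ) λ i → mk⇔ (to i) (from i)))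
  where
  to : ∀ i → IsLRMax (prepend σ) (suc i) → IsLRMax σ i
  to i max j j<i = prepend-<⁻ {σ = σ} {j} {i} (max (suc j) (s≤s j<i))
  from : ∀ i → IsLRMax σ i → IsLRMax (prepend σ) (suc i)
  from i max zero    _         = subst (0 <_) (sym (toℕ-prepend {σ = σ} i)) (s≤s z≤n)
  from i max (suc j) (s≤s j<i) = prepend-< {σ = σ} {j} {i} (max j j<i)

-- A small entry lies below the first entry, while a large one exceeds all small entries and all
-- earlier large ones. The extra 1 counts the first letter.
lrmax-peaked : (c : Vec Bool p) → lrmax (peaked c) ≡ suc (# true c)
lrmax-peaked {p} c = trans
  (length-filter-tabulate (isLRMax? (peaked c)) (Bool._≟ true) {g = lookup d}
    λ i → mk⇔ (to i) (from i))
  (sym (#-filter true d))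
  where
  d : Vec Bool (2 ℕ.+ p)
  d = true ∷ false ∷ c
  to : ∀ i → IsLRMax (peaked c) i → lookup d i ≡ true
  to zero    _   = refl
  to (suc i) max = merge-large⁻ d (suc i)
    (ℕ.≤-trans (ℕ.≤-reflexive (sym (head-peaked c))) (ℕ.<⇒≤ (max zero (s≤s z≤n))))
  from : ∀ i → lookup d i ≡ true → IsLRMax (peaked c) i
  from i eq j j<i with lookup d j in eq′
  ... | true  = merge-increasing d j<i (trans eq′ (sym eq))
  ... | false = ℕ.<-≤-trans (merge-small d j eq′) (merge-large d i eq)

-- Besides the vanishing for k ≥ n, this empties the deletion class at n = k + 1, where the
-- induction for (k*) starts.
Label*⇒< : ∀ {π : Word n} k → Label* (suc k) π → suc k < n
Label*⇒< {n} {π} k (inj₁ e) = subst (_≤ n) (cong suc (length-run _ (suc k))) (EndsIn-length {π = π} e)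
Label*⇒< {suc n} {π} k (inj₂ (_ , ℓ , ℓ<n , k<ℓ , _)) = s≤s (ℕ.<-trans k<ℓ ℓ<n)

-- Generating functions

module Evaluation {c ℓ} (R : CommutativeRing c ℓ) where
  private
    module P = Polynomial R
    module P-ring = CommutativeRing P.commutativeRing
  open CommutativeRing R hiding (zero)
    renaming (refl to ≈-refl; sym to ≈-sym; trans to ≈-trans)
  open import Algebra.Properties.Semiring.Exp semiring
  open import Algebra.Properties.Semiring.Exp P-ring.semiring using () renaming (_^_ to _^ᴾ_)
  open import Algebra.Properties.CommutativeSemigroup +-commutativeSemigroup using (interchange)
  open import Algebra.Properties.CommutativeSemigroup *-commutativeSemigroup using (x∙yz≈y∙xz)
  open import Relation.Binary.Reasoning.Setoid setoid

  module _ (x : Carrier) where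

    eval-+ : ∀ p q → P.eval x (p P.+ q) ≈ P.eval x p + P.eval x q
    eval-+ []      q       = ≈-sym (+-identityˡ _)
    eval-+ (a ∷ p) []      = ≈-sym (+-identityʳ _)
    eval-+ (a ∷ p) (b ∷ q) = begin
      (a + b) + x * P.eval x (p P.+ q)                  ≈⟨ +-congˡ (*-congˡ (eval-+ p q)) ⟩
      (a + b) + x * (P.eval x p + P.eval x q)           ≈⟨ +-congˡ (distribˡ _ _ _) ⟩
      (a + b) + (x * P.eval x p + x * P.eval x q)       ≈⟨ interchange _ _ _ _ ⟩
      (a + x * P.eval x p) + (b + x * P.eval x q)       ∎

    eval-· : ∀ a p → P.eval x (a P.· p) ≈ a * P.eval x p
    eval-· a []      = ≈-sym (zeroʳ a)
    eval-· a (b ∷ p) = begin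
      a * b + x * P.eval x (a P.· p)   ≈⟨ +-congˡ (*-congˡ (eval-· a p)) ⟩
      a * b + x * (a * P.eval x p)     ≈⟨ +-congˡ (x∙yz≈y∙xz _ _ _) ⟩
      a * b + a * (x * P.eval x p)     ≈⟨ distribˡ _ _ _ ⟨
      a * (b + x * P.eval x p)         ∎

    eval-* : ∀ p q → P.eval x (p P.* q) ≈ P.eval x p * P.eval x q
    eval-* []      q = ≈-sym (zeroˡ _)
    eval-* (a ∷ p) q = begin
      P.eval x (a P.· q P.+ (0# ∷ p P.* q))               ≈⟨ eval-+ (a P.· q) (0# ∷ p P.* q) ⟩
      P.eval x (a P.· q) + (0# + x * P.eval x (p P.* q))
        ≈⟨ +-cong (eval-· a q) (≈-trans (+-identityˡ _) (*-congˡ (eval-* p q))) ⟩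
      a * P.eval x q + x * (P.eval x p * P.eval x q)      ≈⟨ +-congˡ (*-assoc _ _ _) ⟨
      a * P.eval x q + x * P.eval x p * P.eval x q        ≈⟨ distribʳ _ _ _ ⟨
      (a + x * P.eval x p) * P.eval x q                   ∎

    eval-constant : ∀ a → P.eval x (P.constant a) ≈ a
    eval-constant a = ≈-trans (+-congˡ (zeroʳ x)) (+-identityʳ a)

    eval-X : P.eval x P.X ≈ x
    eval-X = ≈-trans (+-identityˡ _) (≈-trans (*-congˡ (eval-constant 1#)) (*-identityʳ x))

    eval-^ : ∀ p n → P.eval x (p ^ᴾ n) ≈ P.eval x p ^ n
    eval-^ p zero    = eval-constant 1#
    eval-^ p (suc n) = ≈-trans (eval-* p (p ^ᴾ n)) (*-congˡ (eval-^ p n))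

  1^n≈1 : ∀ n → 1# ^ n ≈ 1#
  1^n≈1 zero    = ≈-refl
  1^n≈1 (suc n) = ≈-trans (*-identityˡ _) (1^n≈1 n)

module Sums {c ℓ} (R : CommutativeRing c ℓ) where
  open CommutativeRing R hiding (zero)
    renaming (refl to ≈-refl; sym to ≈-sym; trans to ≈-trans)
  open import Relation.Binary.Reasoning.Setoid setoid
  open import Algebra.Properties.CommutativeSemigroup +-commutativeSemigroup using (x∙yz≈y∙xz)

  private variable
    A B : Set

  ∑ : List A → (A → Carrier) → Carrier
  ∑ xs f = foldr (λ x s → f x + s) 0# xs

  ∑-cong : ∀ (xs : List A) {f g} → (∀ x → f x ≈ g x) → ∑ xs f ≈ ∑ xs g
  ∑-cong []       eq = ≈-refl
  ∑-cong (x ∷ xs) eq = +-cong (eq x) (∑-cong xs eq)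

  ∑-map : ∀ (g : A → B) xs f → ∑ (List.map g xs) f ≡ ∑ xs (f ∘ g)
  ∑-map g []       f = refl
  ∑-map g (x ∷ xs) f = cong (f (g x) +_) (∑-map g xs f)

  ∑-++ : ∀ (xs ys : List A) f → ∑ (xs ++ ys) f ≈ ∑ xs f + ∑ ys f
  ∑-++ []       ys f = ≈-sym (+-identityˡ _)
  ∑-++ (x ∷ xs) ys f = ≈-trans (+-congˡ (∑-++ xs ys f)) (≈-sym (+-assoc _ _ _))

  ∑-*ˡ : ∀ a (xs : List A) f → ∑ xs (λ x → a * f x) ≈ a * ∑ xs f
  ∑-*ˡ a []       f = ≈-sym (zeroʳ a)
  ∑-*ˡ a (x ∷ xs) f = ≈-trans (+-congˡ (∑-*ˡ a xs f)) (≈-sym (distribˡ _ _ _))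

  ∑-↭ : ∀ {xs ys : List A} f → xs ↭ ys → ∑ xs f ≈ ∑ ys f
  ∑-↭ f Perm.refl         = ≈-refl
  ∑-↭ f (Perm.prep x σ)   = +-congˡ (∑-↭ f σ)
  ∑-↭ f (Perm.swap x y σ) = ≈-trans (x∙yz≈y∙xz _ _ _) (+-congˡ (+-congˡ (∑-↭ f σ)))
  ∑-↭ f (Perm.trans σ τ)  = ≈-trans (∑-↭ f σ) (∑-↭ f τ)

-- Recurrences and their solutions

module Recurrences {c ℓ} (R : CommutativeRing c ℓ) (t : CommutativeRing.Carrier R) where
  open CommutativeRing R hiding (zero)
    renaming (refl to ≈-refl; sym to ≈-sym; trans to ≈-trans)
  open Sums R
  open import Algebra.Properties.Semiring.Exp semiring
  open import Relation.Binary.Reasoning.Setoid setoid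
  open import Algebra.Solver.Ring.NaturalCoefficients.Default commutativeSemiring
    using (solve; _:=_; _:+_; _:*_; con)
  open import Algebra.Properties.Group +-group using (//-rightDividesʳ)
  open import Algebra.Properties.CommutativeSemigroup +-commutativeSemigroup using (xy∙z≈xz∙y)

  S : List (Word n) → Carrier
  S xs = ∑ xs λ π → t ^ lrmax π

  S-none : ∀ {ℓ} {P : Pred (Word n) ℓ} {xs} → (∀ π → ¬ P π) → Enumerates P xs → S xs ≈ 0#
  S-none ¬P e = ∑-↭ _ (Enumerates-↭ e (Enumerates-[] ¬P) λ _ → mk⇔ id id)

  ∑-bits : ∀ p → ∑ (bits p) (λ c → t ^ # true c) ≈ (t + 1#) ^ p
  ∑-bits zero    = +-identityʳ 1#
  ∑-bits (suc p) = begin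
    ∑ (bits (suc p)) f
      ≈⟨ ∑-++ (List.map (true ∷_) (bits p)) (List.map (false ∷_) (bits p)) f ⟩
    ∑ (List.map (true ∷_) (bits p)) f + ∑ (List.map (false ∷_) (bits p)) f
      ≡⟨ cong₂ _+_ (∑-map (true ∷_) (bits p) f) (∑-map (false ∷_) (bits p) f) ⟩
    ∑ (bits p) (λ c → t * t ^ # true c) + ∑ (bits p) (λ c → t ^ # true c)
      ≈⟨ +-cong (≈-trans (∑-*ˡ t (bits p) _) (*-congˡ (∑-bits p))) (∑-bits p) ⟩
    t * (t + 1#) ^ p + (t + 1#) ^ p
      ≈⟨ solve 2 (λ t x → t :* x :+ x := (t :+ con 1) :* x) ≈-refl t _ ⟩
    (t + 1#) * (t + 1#) ^ p ∎
    where
    f : Vec Bool (suc p) → Carrier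
    f c = t ^ # true c

  -- Both classes acquire a factor `t` from the first entry, which is always a left-to-right
  -- maximum.
  recurrence : ∀ {ℓ₁ ℓ₂ ℓ₃}
    {P : Pred (Word (2 ℕ.+ p)) ℓ₁} {Q : Pred (Word (1 ℕ.+ p)) ℓ₂} {R : Pred (Vec Bool p) ℓ₃}
    {xs ys cs} → Enumerates (InF ∩ P) xs → Enumerates (InF ∩ Q) ys → Enumerates R cs →
    (∀ σ → InF σ → P (prepend σ) ⇔ Q σ) → (∀ c → P (peaked c) ⇔ R c) →
    S xs ≈ t * S ys + t * ∑ cs (λ c → t ^ # true c)
  recurrence {xs = xs} {ys} {cs} ex ey ec P⇔Q P⇔R = begin
    S xs
      ≈⟨ ∑-↭ _ (decomposition ex ey ec P⇔Q P⇔R) ⟩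
    S (List.map prepend ys ++ List.map peaked cs)
      ≈⟨ ∑-++ (List.map prepend ys) _ _ ⟩
    S (List.map prepend ys) + S (List.map peaked cs)
      ≡⟨ cong₂ _+_ (∑-map prepend ys _) (∑-map peaked cs _) ⟩
    ∑ ys (λ σ → t ^ lrmax (prepend σ)) + ∑ cs (λ c → t ^ lrmax (peaked c))
      ≈⟨ +-cong (∑-cong ys λ σ → reflexive (cong (t ^_) (lrmax-prepend σ)))
                (∑-cong cs λ c → reflexive (cong (t ^_) (lrmax-peaked c))) ⟩
    ∑ ys (λ σ → t * t ^ lrmax σ) + ∑ cs (λ c → t * t ^ # true c)
      ≈⟨ +-cong (∑-*ˡ t ys _) (∑-*ˡ t cs _) ⟩
    t * S ys + t * ∑ cs (λ c → t ^ # true c) ∎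

  F-polynomial : ∀ p {xs} → Enumerates (InF {suc p}) xs → S xs ≈ t * (t + 1#) ^ p
  F-polynomial zero {xs} e = begin
    S xs                  ≈⟨ ∑-↭ _ (Enumerates-↭ e single (λ _ → mk⇔ id id)) ⟩
    S ((zero ∷ []) ∷ [])  ≈⟨ +-identityʳ _ ⟩
    t * 1#                ∎
    where
    single : Enumerates InF ((zero ∷ []) ∷ [])
    single .unique = [] ∷ []
    single .member (zero ∷ []) = mk⇔ (λ _ → from-yes (inF? (zero ∷ []))) (λ _ → here refl)
  F-polynomial (suc p) {xs} e = step (Enumerates-F (suc p)) (F-polynomial p (Enumerates-F (suc p)))
    where
    with-U : ∀ {n xs} → Enumerates (InF {n}) xs → Enumerates (InF ∩ U) xs
    with-U = Enumerates-⇔ λ _ → mk⇔ (_, _) proj₁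

    step : ∀ {ys} → Enumerates InF ys → S ys ≈ t * (t + 1#) ^ p → S xs ≈ t * (t + 1#) ^ suc p
    step {ys} e′ ih = begin
      S xs
        ≈⟨ recurrence (with-U e) (with-U e′) (Enumerates-bits p) (λ _ _ → mk⇔ _ _) (λ _ → mk⇔ _ _) ⟩
      t * S ys + t * ∑ (bits p) (λ c → t ^ # true c)
        ≈⟨ +-cong (*-congˡ ih) (*-congˡ (∑-bits p)) ⟩
      t * (t * (t + 1#) ^ p) + t * (t + 1#) ^ p
        ≈⟨ solve 2 (λ t x → t :* (t :* x) :+ t :* x := t :* ((t :+ con 1) :* x)) ≈-refl t _ ⟩
      t * (t + 1#) ^ suc p ∎

  ∑-peaks : ∀ r j → ∑ (peaks r j) (λ c → t ^ # true c) ≈ t * (t + 1#) ^ r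
  ∑-peaks r j = begin
    ∑ (peaks r j) (λ c → t ^ # true c)    ≡⟨ ∑-map _ (bits r) _ ⟩
    ∑ (bits r) (λ c → t ^ # true (c Vec.++ true ∷ replicate j false))
      ≈⟨ ∑-cong (bits r) (λ c → reflexive (cong (t ^_) (#true-++ j c))) ⟩
    ∑ (bits r) (λ c → t * t ^ # true c)   ≈⟨ ∑-*ˡ t (bits r) _ ⟩
    t * ∑ (bits r) (λ c → t ^ # true c)   ≈⟨ *-congˡ (∑-bits r) ⟩
    t * (t + 1#) ^ r                      ∎

  -- The subtracted term is moved to the left, so that the semiring solver applies.
  label1a-sum : ∀ r {n xs} → n ≡ 2 ℕ.+ r → Enumerates (InF ∩ Label1a {n}) xs →
                S xs + t ^ n ≈ t ^ 2 * (t + 1#) ^ r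
  -- The induction starts at n = 2, where the sum is empty: 12 has no descent and 21 does not end in
  -- 2.
  label1a-sum zero {xs = xs} refl e = begin
    S xs + t ^ 2                ≈⟨ +-congʳ (recurrence e none none′ (λ σ _ → label1a-prepend {σ = σ}) label1a-peaked) ⟩
    t * 0# + t * 0# + t ^ 2     ≈⟨ solve 1 (λ t → t :* con 0 :+ t :* con 0 :+ t :* (t :* con 1) :=
                                                  t :* (t :* con 1) :* con 1) ≈-refl t ⟩
    t ^ 2 * 1#                  ∎
    where
    none : Enumerates (InF ∩ Label1a {1}) []
    none = Enumerates-[] λ { _ (_ , _ , zero , zero , () , _) }
    none′ : Enumerates (LastPeak 0 {0}) []
    none′ = Enumerates-[] λ _ l → contradiction (LastPeak-length l) λ ()
  label1a-sum (suc r) {xs = xs} refl e =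
    step r (ℕ.+-comm 1 r) e (Enumerates-filter label1a? (Enumerates-F (2 ℕ.+ r)))
      (label1a-sum r refl (Enumerates-filter label1a? (Enumerates-F (2 ℕ.+ r))))
    where
    -- The words in `peaks r 0` have length `r + 1`, which does not reduce to `suc r`; matching on
    -- the equation identifies the two.
    step : ∀ r {p} → p ≡ r ℕ.+ 1 → ∀ {xs ys} → Enumerates (InF ∩ Label1a {2 ℕ.+ p}) xs →
           Enumerates (InF ∩ Label1a {1 ℕ.+ p}) ys → S ys + t ^ (1 ℕ.+ p) ≈ t ^ 2 * (t + 1#) ^ r →
           S xs + t ^ (2 ℕ.+ p) ≈ t ^ 2 * (t + 1#) ^ suc r
    step r {p} refl {xs} {ys} e e′ ih = begin
      S xs + t ^ (2 ℕ.+ p)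
        ≈⟨ +-congʳ (recurrence e e′ (Enumerates-peaks r 0) (λ σ _ → label1a-prepend {σ = σ}) label1a-peaked) ⟩
      t * S ys + t * ∑ (peaks r 0) (λ c → t ^ # true c) + t ^ (2 ℕ.+ p)
        ≈⟨ +-congʳ (+-congˡ (*-congˡ (∑-peaks r 0))) ⟩
      t * S ys + t * (t * (t + 1#) ^ r) + t * t ^ (1 ℕ.+ p)
        ≈⟨ solve 4 (λ t a x y → t :* a :+ t :* (t :* x) :+ t :* y := t :* (a :+ y) :+ t :* (t :* x))
             ≈-refl t (S ys) ((t + 1#) ^ r) (t ^ (1 ℕ.+ p)) ⟩
      t * (S ys + t ^ (1 ℕ.+ p)) + t * (t * (t + 1#) ^ r)
        ≈⟨ +-congʳ (*-congˡ ih) ⟩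
      t * (t * (t * 1#) * (t + 1#) ^ r) + t * (t * (t + 1#) ^ r)
        ≈⟨ solve 2 (λ t x → t :* (t :* (t :* con 1) :* x) :+ t :* (t :* x) :=
                            t :* (t :* con 1) :* ((t :+ con 1) :* x)) ≈-refl t _ ⟩
      t ^ 2 * (t + 1#) ^ suc r ∎

  -- Here `r` is n - k - 1. For `r` = 0 the only labelled permutation is n 1 2 ... n-1, with a
  -- single left-to-right maximum, and this gives the term `t ^ (1 + r)`. For larger `r` that
  -- alternative of `label*-peaked` is ruled out by the length of the word, and the words with their
  -- last peak before `j` small letters remain.
  label*-sum : ∀ j → 1 ≤ j → ∀ r {n xs} → n ≡ 2 ℕ.+ (r ℕ.+ j) →
    Enumerates (InF ∩ Label* {n} (suc j)) xs →
    S xs + t ^ (2 ℕ.+ r) ≈ t ^ 2 * (t + 1#) ^ r + t ^ (1 ℕ.+ r)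
  label*-sum j 1≤j zero {xs = xs} refl e = begin
    S xs + t ^ 2
      ≈⟨ +-congʳ (recurrence e none single (λ σ σ∈F → label*-prepend j {σ} σ∈F 1≤j)
                    λ c → mk⇔ (to c) (from c)) ⟩
    t * 0# + t * (t ^ # true (replicate j false) + 0#) + t ^ 2
      ≈⟨ +-congʳ (+-congˡ (*-congˡ (+-congʳ (reflexive (cong (t ^_) (#true-replicate j)))))) ⟩
    t * 0# + t * (1# + 0#) + t ^ 2
      ≈⟨ solve 1 (λ t → t :* con 0 :+ t :* (con 1 :+ con 0) :+ t :* (t :* con 1) :=
                        t :* (t :* con 1) :* con 1 :+ t :* con 1) ≈-refl t ⟩
    t ^ 2 * 1# + t ^ 1 ∎
    where
    none : Enumerates (InF ∩ Label* {1 ℕ.+ j} (suc j)) []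
    none = Enumerates-[] λ σ (_ , l) → ℕ.<-irrefl refl (Label*⇒< {π = σ} j l)
    single : Enumerates (_≡ replicate j false) (replicate j false ∷ [])
    single .unique   = [] ∷ []
    single .member c = mk⇔ (λ { (here eq) → eq }) here
    to : (c : Vec Bool j) → Label* (suc j) (peaked c) → c ≡ replicate j false
    to c l with Equivalence.to (label*-peaked c j 1≤j) l
    ... | inj₁ (_ , eq) = eq
    ... | inj₂ l′       = contradiction (LastPeak-length l′) (ℕ.<-irrefl refl)
    from : (c : Vec Bool j) → c ≡ replicate j false → Label* (suc j) (peaked c)
    from c eq = Equivalence.from (label*-peaked c j 1≤j) (inj₁ (refl , eq))
  label*-sum j 1≤j (suc r) refl e =
    step r (sym (ℕ.+-suc r j)) e (Enumerates-filter (label*? (suc j)) (Enumerates-F (2 ℕ.+ (r ℕ.+ j))))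
      (label*-sum j 1≤j r refl (Enumerates-filter (label*? (suc j)) (Enumerates-F (2 ℕ.+ (r ℕ.+ j)))))
    where
    step : ∀ r {p} → p ≡ r ℕ.+ suc j → ∀ {xs ys} → Enumerates (InF ∩ Label* {2 ℕ.+ p} (suc j)) xs →
           Enumerates (InF ∩ Label* {1 ℕ.+ p} (suc j)) ys →
           S ys + t ^ (2 ℕ.+ r) ≈ t ^ 2 * (t + 1#) ^ r + t ^ (1 ℕ.+ r) →
           S xs + t ^ (3 ℕ.+ r) ≈ t ^ 2 * (t + 1#) ^ suc r + t ^ (2 ℕ.+ r)
    step r refl {xs} {ys} e e′ ih = begin
      S xs + t ^ (3 ℕ.+ r)
        ≈⟨ +-congʳ (recurrence e e′ (Enumerates-peaks r j)
                      (λ σ σ∈F → label*-prepend j {σ} σ∈F 1≤j) λ c → mk⇔ (to c) (from c)) ⟩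
      t * S ys + t * ∑ (peaks r j) (λ c → t ^ # true c) + t ^ (3 ℕ.+ r)
        ≈⟨ +-congʳ (+-congˡ (*-congˡ (∑-peaks r j))) ⟩
      t * S ys + t * (t * (t + 1#) ^ r) + t * t ^ (2 ℕ.+ r)
        ≈⟨ solve 4 (λ t a x y → t :* a :+ t :* (t :* x) :+ t :* y := t :* (a :+ y) :+ t :* (t :* x))
             ≈-refl t (S ys) ((t + 1#) ^ r) (t ^ (2 ℕ.+ r)) ⟩
      t * (S ys + t ^ (2 ℕ.+ r)) + t * (t * (t + 1#) ^ r)
        ≈⟨ +-congʳ (*-congˡ ih) ⟩
      t * (t * (t * 1#) * (t + 1#) ^ r + t ^ (1 ℕ.+ r)) + t * (t * (t + 1#) ^ r)
        ≈⟨ solve 3 (λ t x y → t :* (t :* (t :* con 1) :* x :+ y) :+ t :* (t :* x) :=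
                              t :* (t :* con 1) :* ((t :+ con 1) :* x) :+ t :* y)
             ≈-refl t ((t + 1#) ^ r) (t ^ (1 ℕ.+ r)) ⟩
      t ^ 2 * (t + 1#) ^ suc r + t ^ (2 ℕ.+ r) ∎
      where
      to : (c : Vec Bool (r ℕ.+ suc j)) → Label* (suc j) (peaked c) → LastPeak j c
      to c l with Equivalence.to (label*-peaked c j 1≤j) l
      ... | inj₁ (eq , _) = contradiction eq (ℕ.m+1+n≢n r)
      ... | inj₂ l′       = l′
      from : (c : Vec Bool (r ℕ.+ suc j)) → LastPeak j c → Label* (suc j) (peaked c)
      from c l = Equivalence.from (label*-peaked c j 1≤j) (inj₂ l)

  x+y≈z⇒x≈z-y : ∀ {x y z} → x + y ≈ z → x ≈ z - y
  x+y≈z⇒x≈z-y {x} {y} eq = ≈-trans (≈-sym (//-rightDividesʳ y x)) (+-congʳ eq)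

  label1a-polynomial : ∀ {n xs} → 2 ≤ n → Enumerates (InF ∩ Label1a {n}) xs →
    S xs ≈ t ^ 2 * (t + 1#) ^ (n ∸ 2) - t ^ n
  label1a-polynomial {n} 2≤n e = x+y≈z⇒x≈z-y (label1a-sum (n ∸ 2) (sym (ℕ.m+[n∸m]≡n 2≤n)) e)

  label*-polynomial : ∀ j {n xs} → 1 ≤ j → suc j < n → Enumerates (InF ∩ Label* {n} (suc j)) xs →
    S xs ≈ t ^ 2 * (t + 1#) ^ (n ∸ suc j ∸ 1) - t ^ suc (n ∸ suc j) + t ^ (n ∸ suc j)
  label*-polynomial j {n} {xs} 1≤j k<n e =
    subst (λ m → S xs ≈ t ^ 2 * (t + 1#) ^ r - t ^ suc m + t ^ m) (sym n∸k≡1+r)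
      (≈-trans (x+y≈z⇒x≈z-y (label*-sum j 1≤j r n≡ e)) (xy∙z≈xz∙y _ _ _))
    where
    r : ℕ
    r = n ∸ suc j ∸ 1
    n∸k≡1+r : n ∸ suc j ≡ suc r
    n∸k≡1+r = sym (ℕ.m+[n∸m]≡n (ℕ.m<n⇒0<n∸m k<n))
    n≡ : n ≡ 2 ℕ.+ (r ℕ.+ j)
    n≡ = trans (sym (ℕ.m∸n+n≡m (ℕ.<⇒≤ k<n)))
           (trans (cong (ℕ._+ suc j) n∸k≡1+r) (cong suc (ℕ.+-suc r j)))

-- Specialisation at q = 1

private
  module E = Evaluation ℤ[t].commutativeRing
  module G = Recurrences ℤ[t].commutativeRing ℤ[t].t

∑-weight∣q=1 : (xs : List (Word n)) → let open ℤ[q,t] using (∑; _∣q=1) in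
               (∑ xs weight) ∣q=1 ℤ[t].≈ G.S xs
∑-weight∣q=1 [] = ℤ[t].refl
∑-weight∣q=1 (π ∷ xs) = begin
  eval₁ (weight π ℤ[q,t].+ ℤ[q,t].∑ xs weight)  ≈⟨ E.eval-+ 1# (weight π) _ ⟩
  eval₁ (weight π) + eval₁ (ℤ[q,t].∑ xs weight) ≈⟨ +-cong weight-eval (∑-weight∣q=1 xs) ⟩
  t ^ lrmax π + G.S xs                          ∎
  where
  open ℤ[t] hiding (refl; sym; trans)
  open import Relation.Binary.Reasoning.Setoid setoid
  open import Algebra.Properties.Semiring.Exp semiring using (^-congˡ)
  module Q = ℤ[q,t]

  eval₁ : Q.Carrier → Carrier
  eval₁ p = p Q.∣q=1

  weight-eval : eval₁ (weight π) ≈ t ^ lrmax π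
  weight-eval = begin
    eval₁ (Q.q Q.^ inv π Q.* Q.t Q.^ lrmax π)
      ≈⟨ E.eval-* 1# (Q.q Q.^ inv π) _ ⟩
    eval₁ (Q.q Q.^ inv π) * eval₁ (Q.t Q.^ lrmax π)
      ≈⟨ *-cong (E.eval-^ 1# Q.q (inv π)) (E.eval-^ 1# Q.t (lrmax π)) ⟩
    eval₁ Q.q ^ inv π * eval₁ Q.t ^ lrmax π
      ≈⟨ *-cong (^-congˡ (inv π) (E.eval-X 1#)) (^-congˡ (lrmax π) (E.eval-constant 1# t)) ⟩
    1# ^ inv π * t ^ lrmax π
      ≈⟨ *-congʳ (E.1^n≈1 (inv π)) ⟩
    1# * t ^ lrmax π
      ≈⟨ *-identityˡ _ ⟩
    t ^ lrmax π ∎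

proposition9p6 : let open ℤ[t] in let open ℤ[q,t] using (_∣q=1) in
    (∀ (n : ℕ) → 3 ≤ n →
    [1a] n ∣q=1 ≈ t ^ 2 * (t + 1#) ^ (n ∸ 2) - t ^ n) ×
    (∀ (n k : ℕ) → 3 ≤ n → 2 ≤ k →
    (k < n →
    [ k *] n ∣q=1 ≈
    t ^ 2 * (t + 1#) ^ (n ∸ k ∸ 1) - t ^ suc (n ∸ k) + t ^ (n ∸ k)) ×
    (n ≤ k → [ k *] n ∣q=1 ≈ 0#)) ×
    (∀ (n : ℕ) → 1 ≤ n → T n ∣q=1 ≈ t * (t + 1#) ^ (n ∸ 1))
proposition9p6 = label1a , (λ { n (suc j) _ (s≤s 1≤j) → label* n j 1≤j , label*-zero n j }) , all
  where
  open ℤ[t] hiding (refl; sym; trans)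
  open ℤ[q,t] using (_∣q=1)

  label1a : ∀ n → 3 ≤ n → [1a] n ∣q=1 ≈ t ^ 2 * (t + 1#) ^ (n ∸ 2) - t ^ n
  label1a n 3≤n = ℤ[t].trans (∑-weight∣q=1 (filter label1a? (F n)))
    (G.label1a-polynomial (ℕ.<⇒≤ 3≤n) (Enumerates-filter label1a? (Enumerates-F n)))

  label* : ∀ n j → 1 ≤ j → suc j < n → [ suc j *] n ∣q=1 ≈
    t ^ 2 * (t + 1#) ^ (n ∸ suc j ∸ 1) - t ^ suc (n ∸ suc j) + t ^ (n ∸ suc j)
  label* n j 1≤j k<n = ℤ[t].trans (∑-weight∣q=1 (filter (label*? (suc j)) (F n)))
    (G.label*-polynomial j 1≤j k<n (Enumerates-filter (label*? (suc j)) (Enumerates-F n)))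

  label*-zero : ∀ n j → n ≤ suc j → [ suc j *] n ∣q=1 ≈ 0#
  label*-zero n j n≤k = ℤ[t].trans (∑-weight∣q=1 (filter (label*? (suc j)) (F n)))
    (G.S-none (λ π (_ , l) → ℕ.<⇒≱ (Label*⇒< {π = π} j l) n≤k)
      (Enumerates-filter (label*? (suc j)) (Enumerates-F n)))

  all : ∀ n → 1 ≤ n → T n ∣q=1 ≈ t * (t + 1#) ^ (n ∸ 1)
  all (suc p) _ = ℤ[t].trans (∑-weight∣q=1 (F (suc p))) (G.F-polynomial p (Enumerates-F (suc p)))
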